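{- Let $q$ be a fixed prime power and let $k\ge 2$ and $t\ge 0$ be fixed integers. Define the sequence $(\alpha_i)_{i\ge 0}$ by $\alpha_0=1$ and $$\alpha_i=-N_k(i)\alpha_0-N_k(i-1)\alpha_1-\cdots-N_k(1)\alpha_{i-1},\qquad i>0.$$ Then, as $m\to\infty$, $$I_k(m)=\sum_{i=0}^t\alpha_i N_k(m-i)+O\Bigl(q^{\binom{m-t-1+k}{k}}\Bigr),$$ where the $O$ concerns only the variable $m$ (the implied constant may depend on $q,k,t$ but not on $m$).
   Context: $\mathbb F_q$ is the finite field with $q$ elements. Two polynomials in $\mathbb F_q[x_1,\dots,x_k]$ are identified if they differ by a factor in $\mathbb F_q^\times$; the classes are called normalized polynomials. $\deg$ denotes the total degree. For an integer $m\ge 0$, $N_k(m)$ is the number of normalized (nonzero) polynomials in $\mathbb F_q[x_1,\dots,x_k]$ of total degree $m$; explicitly $N_k(m)=\frac{q^{\binom{m+k}{k}}-q^{\binom{m+k-1}{k}}}{q-1}$. $I_k(m)$ is the number of those that are irreducible (so $I_k(0)=0$). -}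

module Defs where

open import Algebra.Bundles using (CommutativeRing; RawSemiring)
open import Data.Fin.Base using (Fin; toℕ)
open import Data.Integer.Base using (ℤ)
import Data.Integer.Properties as ℤ
open import Data.Nat.Base as ℕ using (ℕ; zero; suc; _≤_; _<_; _∸_; _^_)
import Data.Nat.Properties as ℕ
open import Data.Nat.Primality using (Prime)
open import Data.Nat.Tactic.RingSolver using (solve-∀)
open import Data.Product.Base using (Σ; ∃; ∃₂; _×_; _,_; proj₁)
open import Data.Vec.Base as Vec using (Vec; []; _∷_)
open import Data.Vec.Properties using (≡-dec)
open import Function.Bundles using (Inverse)
open import Level using (Level; _⊔_) renaming (suc to lsuc)
open import Relation.Binary.Bundles using (Setoid)
import Relation.Binary.Construct.On as On
open import Relation.Binary.PropositionalEquality as ≡ using (_≡_)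
open import Relation.Nullary using (¬_; yes; no; contradiction)

import Algebra.Definitions.RawSemiring
import Algebra.Properties.CommutativeMonoid.Sum
import Algebra.Properties.Semiring.Sum
import Relation.Binary.Reasoning.Setoid

_HasCardinality_ : ∀ {a ℓ} → Setoid a ℓ → ℕ → Set (a ⊔ ℓ)
S HasCardinality n = Inverse S (≡.setoid (Fin n))

IsPrimePower : ℕ → Set
IsPrimePower q = ∃₂ λ p r → Prime p × 1 ≤ r × q ≡ p ^ r

record FiniteField (c ℓ : Level) (q : ℕ) : Set (lsuc (c ⊔ ℓ)) where
  field
    commutativeRing : CommutativeRing c ℓ
  open CommutativeRing commutativeRing public
  field
    1≉0         : 1# ≉ 0#
    inverse     : ∀ x → x ≉ 0# → ∃ λ y → x * y ≈ 1#
    cardinality : setoid HasCardinality q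

-- The monomial x₁^μ₁ ⋯ x_k^μ_k is represented by its exponent vector μ.
Monomial : ℕ → Set
Monomial k = Vec ℕ k

∣_∣ₘ : ∀ {k} → Monomial k → ℕ
∣ μ ∣ₘ = Vec.sum μ

module Polynomials {c ℓ q} (F : FiniteField c ℓ q) (k : ℕ) where

  open FiniteField F
  open Algebra.Properties.CommutativeMonoid.Sum +-commutativeMonoid
    using (sum; sum-cong-≋; sum-replicate-zero)

  -- The bound on the support is only a witness of finiteness; it need not be
  -- optimal, and _≈ₚ_ ignores it.
  record Polynomial : Set (c ⊔ ℓ) where
    constructor mkPolynomial
    field
      coeff  : Monomial k → Carrier
      finite : ∃ λ d → ∀ μ → d < ∣ μ ∣ₘ → coeff μ ≈ 0#

  open Polynomial public

  infix 4 _≈ₚ_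
  _≈ₚ_ : Polynomial → Polynomial → Set ℓ
  f ≈ₚ g = ∀ μ → coeff f μ ≈ coeff g μ

  HasDegree : Polynomial → ℕ → Set ℓ
  HasDegree f m = (∃ λ μ → ∣ μ ∣ₘ ≡ m × coeff f μ ≉ 0#)
                × (∀ μ → m < ∣ μ ∣ₘ → coeff f μ ≈ 0#)

  constant : Carrier → Polynomial
  constant a = mkPolynomial coefficient (0 , vanishes)
    where
    1ₘ : Monomial k
    1ₘ = Vec.replicate k 0
    coefficient : Monomial k → Carrier
    coefficient μ with ≡-dec ℕ._≟_ μ 1ₘ
    ... | yes _ = a
    ... | no  _ = 0#
    sum-1ₘ : ∀ n → Vec.sum (Vec.replicate n 0) ≡ 0
    sum-1ₘ zero    = ≡.refl
    sum-1ₘ (suc n) = sum-1ₘ n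
    vanishes : ∀ μ → 0 < ∣ μ ∣ₘ → coefficient μ ≈ 0#
    vanishes μ 0<μ with ≡-dec ℕ._≟_ μ 1ₘ
    ... | yes ≡.refl = contradiction (sum-1ₘ k) (ℕ.>⇒≢ 0<μ)
    ... | no  _      = refl

  infixl 6 _+ₚ_
  _+ₚ_ : Polynomial → Polynomial → Polynomial
  mkPolynomial f (d , f≈0) +ₚ mkPolynomial g (e , g≈0) =
    mkPolynomial (λ μ → f μ + g μ) (d ℕ.⊔ e , λ μ d⊔e<μ →
      trans (+-cong (f≈0 μ (ℕ.≤-<-trans (ℕ.m≤m⊔n d e) d⊔e<μ))
                    (g≈0 μ (ℕ.≤-<-trans (ℕ.m≤n⊔m d e) d⊔e<μ)))
            (+-identityʳ 0#))

  -- convolution f g μ = ∑ f ν * g ρ over all ν, ρ with ν + ρ = μ, summing over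
  -- one exponent at a time.
  convolution : ∀ {n} → (Monomial n → Carrier) → (Monomial n → Carrier) →
                Monomial n → Carrier
  convolution f g []      = f [] * g []
  convolution f g (e ∷ μ) = sum {suc e} λ i →
    convolution (λ ν → f (toℕ i ∷ ν)) (λ ρ → g (e ∸ toℕ i ∷ ρ)) μ

  convolution-zero : ∀ {n} f g (μ : Monomial n) →
    (∀ ν ρ → ∣ ν ∣ₘ ℕ.+ ∣ ρ ∣ₘ ≡ ∣ μ ∣ₘ → f ν * g ρ ≈ 0#) →
    convolution f g μ ≈ 0#
  convolution-zero f g []      fg≈0 = fg≈0 [] [] ≡.refl
  convolution-zero f g (e ∷ μ) fg≈0 =
    trans (sum-cong-≋ {suc e} λ i → convolution-zero _ _ μ λ ν ρ eq →
             fg≈0 (toℕ i ∷ ν) (e ∸ toℕ i ∷ ρ) (size (ℕ.≤-pred (toℕ<n i)) eq))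
          (sum-replicate-zero (suc e))
    where
    open import Data.Fin.Properties using (toℕ<n)
    shuffle : ∀ a b x y → (a ℕ.+ x) ℕ.+ (b ℕ.+ y) ≡ (a ℕ.+ b) ℕ.+ (x ℕ.+ y)
    shuffle = solve-∀
    size : ∀ {i x y} → i ≤ e → x ℕ.+ y ≡ ∣ μ ∣ₘ →
           (i ℕ.+ x) ℕ.+ ((e ∸ i) ℕ.+ y) ≡ e ℕ.+ ∣ μ ∣ₘ
    size {i} {x} {y} i≤e eq =
      ≡.trans (shuffle i (e ∸ i) x y) (≡.cong₂ ℕ._+_ (ℕ.m+[n∸m]≡n i≤e) eq)

  infixl 7 _*ₚ_
  _*ₚ_ : Polynomial → Polynomial → Polynomial
  mkPolynomial f (d , f≈0) *ₚ mkPolynomial g (e , g≈0) =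
    mkPolynomial (convolution f g) (d ℕ.+ e , λ μ d+e<μ →
      convolution-zero f g μ λ ν ρ eq → term ν ρ (≡.subst (d ℕ.+ e <_) (≡.sym eq) d+e<μ))
    where
    term : ∀ ν ρ → d ℕ.+ e < ∣ ν ∣ₘ ℕ.+ ∣ ρ ∣ₘ → f ν * g ρ ≈ 0#
    term ν ρ lt with d ℕ.<? ∣ ν ∣ₘ | e ℕ.<? ∣ ρ ∣ₘ
    ... | yes d<ν | _       = trans (*-congʳ (f≈0 ν d<ν)) (zeroˡ _)
    ... | no  _   | yes e<ρ = trans (*-congˡ (g≈0 ρ e<ρ)) (zeroʳ _)
    ... | no  d≮ν | no  e≮ρ =
      contradiction lt (ℕ.≤⇒≯ (ℕ.+-mono-≤ (ℕ.≮⇒≥ d≮ν) (ℕ.≮⇒≥ e≮ρ)))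

  rawSemiring : RawSemiring (c ⊔ ℓ) ℓ
  rawSemiring = record
    { Carrier = Polynomial
    ; _≈_     = _≈ₚ_
    ; _+_     = _+ₚ_
    ; _*_     = _*ₚ_
    ; 0#      = constant 0#
    ; 1#      = constant 1#
    }

  open Algebra.Definitions.RawSemiring rawSemiring public using (Irreducible)

  infix 4 _∼_
  _∼_ : Polynomial → Polynomial → Set (c ⊔ ℓ)
  f ∼ g = ∃ λ a → a ≉ 0# × (∀ μ → coeff g μ ≈ a * coeff f μ)

  -- Setoid equality is the identification of polynomials up to a nonzero
  -- constant, so elements of this setoid are normalized polynomials.
  normalizedSetoid : Setoid (c ⊔ ℓ) (c ⊔ ℓ)
  normalizedSetoid = record
    { Carrier       = Polynomial
    ; _≈_           = _∼_
    ; isEquivalence = record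
      { refl  = λ {f} → ∼-refl {f}
      ; sym   = λ {f g} → ∼-sym {f} {g}
      ; trans = λ {f g h} → ∼-trans {f} {g} {h}
      }
    }
    where
    open Relation.Binary.Reasoning.Setoid setoid
    unit≉0 : ∀ {a b} → a * b ≈ 1# → b ≉ 0#
    unit≉0 ab≈1 b≈0 = 1≉0 (trans (sym ab≈1) (trans (*-congˡ b≈0) (zeroʳ _)))
    cancel : ∀ {a b} → a * b ≈ 1# → ∀ x → x ≈ b * (a * x)
    cancel {a} {b} ab≈1 x = begin
      x            ≈⟨ *-identityˡ x ⟨
      1# * x       ≈⟨ *-congʳ ab≈1 ⟨
      (a * b) * x  ≈⟨ *-congʳ (*-comm a b) ⟩
      (b * a) * x  ≈⟨ *-assoc b a x ⟩
      b * (a * x)  ∎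
    ∼-refl : ∀ {f} → f ∼ f
    ∼-refl = 1# , 1≉0 , λ μ → sym (*-identityˡ _)
    ∼-sym : ∀ {f g} → f ∼ g → g ∼ f
    ∼-sym (a , a≉0 , g≈af) with inverse a a≉0
    ... | b , ab≈1 = b , unit≉0 ab≈1 , λ μ →
      trans (cancel ab≈1 _) (*-congˡ (sym (g≈af μ)))
    ∼-trans : ∀ {f g h} → f ∼ g → g ∼ h → f ∼ h
    ∼-trans (a , a≉0 , g≈af) (b , b≉0 , h≈bg) with inverse b b≉0
    ... | b⁻¹ , bb⁻¹≈1 = b * a , ba≉0 , λ μ →
      trans (h≈bg μ) (trans (*-congˡ (g≈af μ)) (sym (*-assoc b a _)))
      where
      ba≉0 : b * a ≉ 0#
      ba≉0 ba≈0 = a≉0 (trans (cancel bb⁻¹≈1 a) (trans (*-congˡ ba≈0) (zeroʳ b⁻¹)))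

  NormalizedOfDegree : ℕ → Setoid (c ⊔ ℓ) (c ⊔ ℓ)
  NormalizedOfDegree m =
    On.setoid {B = Σ Polynomial λ f → HasDegree f m} normalizedSetoid proj₁

  IrreducibleOfDegree : ℕ → Setoid (c ⊔ ℓ) (c ⊔ ℓ)
  IrreducibleOfDegree m =
    On.setoid {B = Σ Polynomial λ f → HasDegree f m × Irreducible f}
      normalizedSetoid proj₁

open Polynomials public using (NormalizedOfDegree; IrreducibleOfDegree)

∑ℤ : (n : ℕ) → (ℕ → ℤ) → ℤ
∑ℤ n f = sum {n} λ i → f (toℕ i)
  where open Algebra.Properties.Semiring.Sum ℤ.+-*-semiring using (sum)

{-# OPTIONS --safe #-}
-- The ring 𝔽_q[x₁, …, x_k] is a GCD domain (Gauss's lemma, one variable at a time),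
-- so an irreducible polynomial dividing a product of which one factor has smaller
-- degree divides the other factor. Put s = t + 1. For large m, a polynomial of degree m
-- either has an irreducible factor of degree m - i with i ≤ t, which is then unique
-- up to constants, or is a product of two polynomials of degree at least s.
-- Hence N(m) = ∑_{i ≤ t} N(i) I(m - i) + e with 0 ≤ e ≤ N(s) N(m - s) + ∑ N(d) N(m - d)
-- over s < d < m - s. Since N(d) ≤ q^b(d) for the convex function
-- b(d) = C(d + k, k), whose increments grow at least linearly when k ≥ 2,
-- e = O(q^b(m - s)). As α is the inverse of N for the Cauchy product, combining these
-- formulas for m - i and t - i in place of m and t gives the claim.
module Submission where

open import Defs
open import Algebra.Bundles using (CommutativeRing)
open import Algebra.Definitions.RawMagma using (_,_)
open import Algebra.Definitions.RawSemiring using (mkIrred)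
open import Data.Fin.Base as Fin using (Fin; toℕ; zero; suc; combine)
import Data.Fin.Properties as Fin
open import Data.List.Base as List using (List; []; _∷_; applyUpTo; length)
open import Data.List.Properties using (length-map)
open import Data.Nat.Base as ℕ using (ℕ; zero; suc; _∸_; _≤_; _<_; z≤n; s≤s; _^_; NonZero)
open import Data.Nat.Combinatorics using (_C_; nCn≡1; nCk+nC[k+1]≡[n+1]C[k+1])
open import Data.Nat.Primality using (prime⇒nonTrivial; prime⇒nonZero)
import Data.Nat.Properties as ℕ
open import Data.Product.Base using (Σ; ∃; ∃₂; _×_; _,_; proj₁; proj₂)
open import Data.Sum.Base as Sum using (_⊎_; inj₁; inj₂)
open import Data.Sum.Function.Propositional using (_⊎-↔_)
open import Data.Vec.Base as Vec using ([]; _∷_)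
open import Data.Vec.Properties using (≡-dec)
open import Function.Base using (_∘_; id)
open import Function.Bundles using (Inverse; _↔_; mk↔ₛ′)
open import Function.Construct.Composition using (_↔-∘_)
open import Function.Construct.Identity using (↔-id)
open import Level using (_⊔_)
open import Relation.Binary.Bundles using (Setoid)
import Relation.Binary.Construct.On as On
open import Relation.Binary.Definitions using (tri<; tri≈; tri>)
open import Relation.Binary.PropositionalEquality as ≡ using (_≡_)
open import Relation.Nullary using (¬_; Dec; yes; no; contradiction)
open import Relation.Nullary.Decidable using (map′)

import Algebra.Properties.AbelianGroup
import Algebra.Properties.CommutativeSemigroup
import Algebra.Properties.Ring
import Algebra.Properties.Semiring.Divisibility
import Algebra.Properties.Semiring.Primality
import Algebra.Properties.Semiring.Sum
import Relation.Binary.Reasoning.Setoid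

-- Polynomials in one variable

-- Gcds carry the uniqueness argument because they are computable: the gcd of an irreducible p with
-- x is a unit or an associate of p, and for deg x < deg p only the first is possible. In the
-- statement, polynomials are coefficient functions, which offer no recursion on the number of
-- variables; the algebra therefore takes place in iterated lists and is carried over coefficient by
-- coefficient. Counts are compared through injections between finite types, with associates in
-- place of proportional polynomials. The delicate part of the error is the sum over s < d < m - s:
-- it has about m terms, and no factor growing with m may survive. Convexity puts each term below
-- q^(b(s + 1) + b(m - s - 1)), and b(m - s) - b(m - s - 1) ≥ m - s - 1 leaves a spare factor q^(m -
-- s - 1) that absorbs their number. For k = 1 this increment is 1 and the argument breaks down.

module CauchyProduct {c ℓ} (R : CommutativeRing c ℓ) where

  open CommutativeRing R
  open Algebra.Properties.Semiring.Sum semiring using (sum; sum-cong-≋; *-distribˡ-sum)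
  open Algebra.Properties.CommutativeSemigroup +-commutativeSemigroup
    using (interchange; x∙yz≈y∙xz)
  open Relation.Binary.Reasoning.Setoid setoid

  infixl 7 _⊛_
  -- At `suc n` this unfolds definitionally into `f 0 * g (suc n) + ((f ∘ suc) ⊛ g) n`. The
  -- inductions below use this and shift the left factor.
  _⊛_ : (ℕ → Carrier) → (ℕ → Carrier) → ℕ → Carrier
  (f ⊛ g) n = sum {suc n} λ i → f (toℕ i) * g (n ∸ toℕ i)

  ⊛-cong : ∀ {f f′ g g′} → (∀ i → f i ≈ f′ i) → (∀ i → g i ≈ g′ i) →
           ∀ n → (f ⊛ g) n ≈ (f′ ⊛ g′) n
  ⊛-cong f≈f′ g≈g′ n =
    sum-cong-≋ {suc n} λ i → *-cong (f≈f′ (toℕ i)) (g≈g′ (n ∸ toℕ i))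

  ⊛-congʳ : ∀ {f f′} g → (∀ i → f i ≈ f′ i) → ∀ n → (f ⊛ g) n ≈ (f′ ⊛ g) n
  ⊛-congʳ g f≈f′ = ⊛-cong {g = g} f≈f′ λ _ → refl

  ⊛-congˡ : ∀ f {g g′} → (∀ i → g i ≈ g′ i) → ∀ n → (f ⊛ g) n ≈ (f ⊛ g′) n
  ⊛-congˡ f = ⊛-cong {f = f} λ _ → refl

  ⊛-zeroˡ : ∀ {f} g → (∀ i → f i ≈ 0#) → ∀ n → (f ⊛ g) n ≈ 0#
  ⊛-zeroˡ g f≈0 zero    = trans (+-identityʳ _) (trans (*-congʳ (f≈0 0)) (zeroˡ _))
  ⊛-zeroˡ g f≈0 (suc n) =
    trans (+-cong (trans (*-congʳ (f≈0 0)) (zeroˡ _)) (⊛-zeroˡ g (f≈0 ∘ suc) n))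
          (+-identityʳ 0#)

  -- The mirror image of the definitional unfolding, shifting the right factor; comparing the two
  -- gives commutativity.
  ⊛-peelʳ : ∀ f g n → (f ⊛ g) (suc n) ≈ f (suc n) * g 0 + (f ⊛ (g ∘ suc)) n
  ⊛-peelʳ f g zero    = x∙yz≈y∙xz _ _ _
  ⊛-peelʳ f g (suc n) = trans (+-congˡ (⊛-peelʳ (f ∘ suc) g n)) (x∙yz≈y∙xz _ _ _)

  ⊛-comm : ∀ f g n → (f ⊛ g) n ≈ (g ⊛ f) n
  ⊛-comm f g zero    = +-congʳ (*-comm _ _)
  ⊛-comm f g (suc n) =
    trans (+-cong (*-comm _ _) (⊛-comm (f ∘ suc) g n)) (sym (⊛-peelʳ g f n))

  ⊛-distribʳ : ∀ h f g n → ((λ i → f i + g i) ⊛ h) n ≈ (f ⊛ h) n + (g ⊛ h) n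
  ⊛-distribʳ h f g zero    = begin
    (f 0 + g 0) * h 0 + 0#            ≈⟨ +-congˡ (+-identityʳ 0#) ⟨
    (f 0 + g 0) * h 0 + (0# + 0#)     ≈⟨ +-congʳ (distribʳ _ _ _) ⟩
    (f 0 * h 0 + g 0 * h 0) + (0# + 0#) ≈⟨ interchange _ _ _ _ ⟩
    (f 0 * h 0 + 0#) + (g 0 * h 0 + 0#) ∎
  ⊛-distribʳ h f g (suc n) =
    trans (+-cong (distribʳ _ _ _) (⊛-distribʳ h (f ∘ suc) (g ∘ suc) n)) (interchange _ _ _ _)

  ⊛-scaleˡ : ∀ a f g n → ((λ i → a * f i) ⊛ g) n ≈ a * (f ⊛ g) n
  ⊛-scaleˡ a f g n = trans (sum-cong-≋ {suc n} λ i → *-assoc a (f (toℕ i)) (g (n ∸ toℕ i)))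
                           (sym (*-distribˡ-sum {suc n} a λ i → f (toℕ i) * g (n ∸ toℕ i)))

  -- The shift of `f ⊛ g` is `f 0` times the shift of g, plus `(f ∘ suc) ⊛ g`; distributivity and
  -- scaling then reduce to the induction hypothesis for `f ∘ suc`.
  ⊛-assoc : ∀ f g h n → ((f ⊛ g) ⊛ h) n ≈ (f ⊛ (g ⊛ h)) n
  ⊛-assoc f g h zero    = +-congʳ (begin
    (f 0 * g 0 + 0#) * h 0 ≈⟨ *-congʳ (+-identityʳ _) ⟩
    f 0 * g 0 * h 0        ≈⟨ *-assoc _ _ _ ⟩
    f 0 * (g 0 * h 0)      ≈⟨ *-congˡ (+-identityʳ _) ⟨
    f 0 * (g 0 * h 0 + 0#) ∎)
  ⊛-assoc f g h (suc n) = begin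
    (f ⊛ g) 0 * h (suc n) + (((f ⊛ g) ∘ suc) ⊛ h) n
      ≈⟨ +-cong (trans (*-congʳ (+-identityʳ _)) (*-assoc _ _ _))
                (⊛-distribʳ h (λ i → f 0 * g (suc i)) ((f ∘ suc) ⊛ g) n) ⟩
    f 0 * (g 0 * h (suc n)) + (((λ i → f 0 * g (suc i)) ⊛ h) n + (((f ∘ suc) ⊛ g) ⊛ h) n)
      ≈⟨ +-congˡ (+-cong (⊛-scaleˡ (f 0) (g ∘ suc) h n) (⊛-assoc (f ∘ suc) g h n)) ⟩
    f 0 * (g 0 * h (suc n)) + (f 0 * ((g ∘ suc) ⊛ h) n + ((f ∘ suc) ⊛ (g ⊛ h)) n)
      ≈⟨ +-assoc _ _ _ ⟨
    f 0 * (g 0 * h (suc n)) + f 0 * ((g ∘ suc) ⊛ h) n + ((f ∘ suc) ⊛ (g ⊛ h)) n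
      ≈⟨ +-congʳ (distribˡ _ _ _) ⟨
    (f ⊛ (g ⊛ h)) (suc n) ∎

module PolynomialRing {c ℓ} (R : CommutativeRing c ℓ) where

  open CommutativeRing R
  open CauchyProduct R
  open Algebra.Properties.Ring ring using (-0#≈0#)

  -- Constant coefficient first; _≋_ ignores trailing zeros.
  Poly : Set c
  Poly = List Carrier

  coeff : Poly → ℕ → Carrier
  coeff []      _       = 0#
  coeff (a ∷ f) zero    = a
  coeff (a ∷ f) (suc i) = coeff f i

  infix 4 _≋_
  -- A record rather than a bare function type, so that unification can recover f and g from the
  -- type of a proof.
  record _≋_ (f g : Poly) : Set ℓ where
    constructor coeffwise
    field at : ∀ i → coeff f i ≈ coeff g i

  open _≋_ public

  infixl 6 _⊕_
  _⊕_ : Poly → Poly → Poly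
  []      ⊕ g       = g
  (a ∷ f) ⊕ []      = a ∷ f
  (a ∷ f) ⊕ (b ∷ g) = a + b ∷ f ⊕ g

  infixr 8 _•_
  _•_ : Carrier → Poly → Poly
  a • f = List.map (a *_) f

  infixl 7 _⊗_
  _⊗_ : Poly → Poly → Poly
  []      ⊗ g = []
  (a ∷ f) ⊗ g = a • g ⊕ (0# ∷ f ⊗ g)

  ⊖_ : Poly → Poly
  ⊖_ = List.map (-_)

  coeff-⊕ : ∀ f g i → coeff (f ⊕ g) i ≈ coeff f i + coeff g i
  coeff-⊕ []      g       i       = sym (+-identityˡ _)
  coeff-⊕ (a ∷ f) []      i       = sym (+-identityʳ _)
  coeff-⊕ (a ∷ f) (b ∷ g) zero    = refl
  coeff-⊕ (a ∷ f) (b ∷ g) (suc i) = coeff-⊕ f g i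

  coeff-• : ∀ a f i → coeff (a • f) i ≈ a * coeff f i
  coeff-• a []      i       = sym (zeroʳ a)
  coeff-• a (b ∷ f) zero    = refl
  coeff-• a (b ∷ f) (suc i) = coeff-• a f i

  coeff-⊖ : ∀ f i → coeff (⊖ f) i ≈ - coeff f i
  coeff-⊖ []      i       = sym -0#≈0#
  coeff-⊖ (b ∷ f) zero    = refl
  coeff-⊖ (b ∷ f) (suc i) = coeff-⊖ f i

  -- Through this the ring laws of `_⊗_` are read off from those of `_⊛_`, where list lengths do not
  -- interfere.
  coeff-⊗ : ∀ f g i → coeff (f ⊗ g) i ≈ (coeff f ⊛ coeff g) i
  coeff-⊗ []      g i       = sym (⊛-zeroˡ (coeff g) (λ _ → refl) i)
  coeff-⊗ (a ∷ f) g zero    = trans (coeff-⊕ (a • g) _ 0) (+-congʳ (coeff-• a g 0))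
  coeff-⊗ (a ∷ f) g (suc i) =
    trans (coeff-⊕ (a • g) _ (suc i)) (+-cong (coeff-• a g (suc i)) (coeff-⊗ f g i))

  ⊗-cong : ∀ {f f′ g g′} → f ≋ f′ → g ≋ g′ → f ⊗ g ≋ f′ ⊗ g′
  ⊗-cong {f} {f′} {g} {g′} f≋f′ g≋g′ = coeffwise λ i →
    trans (coeff-⊗ f g i) (trans (⊛-cong (at f≋f′) (at g≋g′) i) (sym (coeff-⊗ f′ g′ i)))

  ⊗-comm : ∀ f g → f ⊗ g ≋ g ⊗ f
  ⊗-comm f g = coeffwise λ i →
    trans (coeff-⊗ f g i) (trans (⊛-comm (coeff f) (coeff g) i) (sym (coeff-⊗ g f i)))

  ⊗-assoc : ∀ f g h → (f ⊗ g) ⊗ h ≋ f ⊗ (g ⊗ h)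
  ⊗-assoc f g h = coeffwise λ i → begin
    coeff ((f ⊗ g) ⊗ h) i             ≈⟨ coeff-⊗ (f ⊗ g) h i ⟩
    (coeff (f ⊗ g) ⊛ coeff h) i       ≈⟨ ⊛-congʳ (coeff h) (coeff-⊗ f g) i ⟩
    ((coeff f ⊛ coeff g) ⊛ coeff h) i ≈⟨ ⊛-assoc (coeff f) (coeff g) (coeff h) i ⟩
    (coeff f ⊛ (coeff g ⊛ coeff h)) i ≈⟨ ⊛-congˡ (coeff f) (coeff-⊗ g h) i ⟨
    (coeff f ⊛ coeff (g ⊗ h)) i       ≈⟨ coeff-⊗ f (g ⊗ h) i ⟨
    coeff (f ⊗ (g ⊗ h)) i             ∎
    where open Relation.Binary.Reasoning.Setoid setoid

  ⊗-distribʳ : ∀ h f g → (f ⊕ g) ⊗ h ≋ f ⊗ h ⊕ g ⊗ h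
  ⊗-distribʳ h f g = coeffwise λ i → begin
    coeff ((f ⊕ g) ⊗ h) i
      ≈⟨ coeff-⊗ (f ⊕ g) h i ⟩
    (coeff (f ⊕ g) ⊛ coeff h) i
      ≈⟨ ⊛-congʳ (coeff h) (coeff-⊕ f g) i ⟩
    ((λ j → coeff f j + coeff g j) ⊛ coeff h) i
      ≈⟨ ⊛-distribʳ (coeff h) (coeff f) (coeff g) i ⟩
    (coeff f ⊛ coeff h) i + (coeff g ⊛ coeff h) i
      ≈⟨ +-cong (coeff-⊗ f h i) (coeff-⊗ g h i) ⟨
    coeff (f ⊗ h) i + coeff (g ⊗ h) i
      ≈⟨ coeff-⊕ (f ⊗ h) (g ⊗ h) i ⟨
    coeff (f ⊗ h ⊕ g ⊗ h) i ∎
    where open Relation.Binary.Reasoning.Setoid setoid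

  ⊗-scaleˡ : ∀ a f g → (a • f) ⊗ g ≋ a • (f ⊗ g)
  ⊗-scaleˡ a f g = coeffwise λ i → begin
    coeff (a • f ⊗ g) i                   ≈⟨ coeff-⊗ (a • f) g i ⟩
    (coeff (a • f) ⊛ coeff g) i           ≈⟨ ⊛-congʳ (coeff g) (coeff-• a f) i ⟩
    ((λ j → a * coeff f j) ⊛ coeff g) i   ≈⟨ ⊛-scaleˡ a (coeff f) (coeff g) i ⟩
    a * (coeff f ⊛ coeff g) i             ≈⟨ *-congˡ (coeff-⊗ f g i) ⟨
    a * coeff (f ⊗ g) i                   ≈⟨ coeff-• a (f ⊗ g) i ⟨
    coeff (a • (f ⊗ g)) i                 ∎
    where open Relation.Binary.Reasoning.Setoid setoid

  ⊗-identityˡ : ∀ f → (1# ∷ []) ⊗ f ≋ f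
  ⊗-identityˡ f = coeffwise λ
    { zero    → trans (coeff-⊗ (1# ∷ []) f 0) (trans (+-identityʳ _) (*-identityˡ _))
    ; (suc i) → trans (coeff-⊗ (1# ∷ []) f (suc i))
        (trans (+-cong (*-identityˡ _) (⊛-zeroˡ (coeff f) (λ _ → refl) i)) (+-identityʳ _)) }

  ≋-trans : ∀ {f g h} → f ≋ g → g ≋ h → f ≋ h
  ≋-trans f≋g g≋h = coeffwise λ i → trans (at f≋g i) (at g≋h i)

  polynomialRing : CommutativeRing c ℓ
  polynomialRing = record
    { Carrier = Poly ; _≈_ = _≋_ ; _+_ = _⊕_ ; _*_ = _⊗_ ; -_ = ⊖_ ; 0# = [] ; 1# = 1# ∷ []
    ; isCommutativeRing = record
      { isRing = record
        { +-isAbelianGroup = record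
          { isGroup = record
            { isMonoid = record
              { isSemigroup = record
                { isMagma = record
                  { isEquivalence = record
                    { refl  = coeffwise λ _ → refl
                    ; sym   = λ f≋g → coeffwise λ i → sym (at f≋g i)
                    ; trans = ≋-trans
                    }
                  ; ∙-cong = λ {f f′ g g′} f≋f′ g≋g′ → coeffwise λ i →
                      trans (coeff-⊕ f g i)
                        (trans (+-cong (at f≋f′ i) (at g≋g′ i)) (sym (coeff-⊕ f′ g′ i)))
                  }
                ; assoc = λ f g h → coeffwise λ i →
                    trans (trans (coeff-⊕ (f ⊕ g) h i) (+-congʳ (coeff-⊕ f g i)))
                      (trans (+-assoc _ _ _)
                        (sym (trans (coeff-⊕ f (g ⊕ h) i) (+-congˡ (coeff-⊕ g h i)))))
                }
              ; identity = (λ f → coeffwise λ _ → refl)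
                         , (λ f → coeffwise λ i → trans (coeff-⊕ f [] i) (+-identityʳ _))
              }
            ; inverse = (λ f → coeffwise λ i → trans (coeff-⊕ (⊖ f) f i)
                           (trans (+-congʳ (coeff-⊖ f i)) (-‿inverseˡ _)))
                      , (λ f → coeffwise λ i → trans (coeff-⊕ f (⊖ f) i)
                           (trans (+-congˡ (coeff-⊖ f i)) (-‿inverseʳ _)))
            ; ⁻¹-cong = λ {f g} f≋g → coeffwise λ i →
                trans (coeff-⊖ f i) (trans (-‿cong (at f≋g i)) (sym (coeff-⊖ g i)))
            }
          ; comm = λ f g → coeffwise λ i →
              trans (coeff-⊕ f g i) (trans (+-comm _ _) (sym (coeff-⊕ g f i)))
          }
        ; *-cong     = ⊗-cong
        ; *-assoc    = ⊗-assoc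
        ; *-identity = ⊗-identityˡ , λ f → ≋-trans (⊗-comm f _) (⊗-identityˡ f)
        ; distrib    = (λ f g h → ≋-trans (⊗-comm f _) (≋-trans (⊗-distribʳ f g h)
                         (coeffwise λ i → trans (coeff-⊕ (g ⊗ f) (h ⊗ f) i)
                           (trans (+-cong (at (⊗-comm g f) i) (at (⊗-comm h f) i))
                             (sym (coeff-⊕ (f ⊗ g) (f ⊗ h) i))))))
                     , ⊗-distribʳ
        }
      ; *-comm = ⊗-comm
      }
    }

-- Gauss's lemma

module Divisibility {c ℓ} (R : CommutativeRing c ℓ) where

  open CommutativeRing R
  open Algebra.Properties.Semiring.Divisibility semiring public
    using (_∣_; _∥_; _∣0; 0∣x⇒x≈0)
    renaming (∣ʳ-refl to ∣-refl; ∣ʳ-trans to ∣-trans; ∣ʳ-respʳ-≈ to ∣-respʳ;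
              ∣ʳ-respˡ-≈ to ∣-respˡ; x∣ʳy⇒x∣ʳzy to ∣-*ˡ; ε∣ʳ_ to 1∣_)
  open Algebra.Properties.Semiring.Primality semiring public using (Irreducible)
  open Algebra.Properties.Ring ring
    using (-‿distribˡ-*)
  open Algebra.Properties.AbelianGroup +-abelianGroup using (xyx⁻¹≈y)
  open Algebra.Properties.CommutativeSemigroup *-commutativeSemigroup using (interchange)

  ∣-*ʳ : ∀ {x y} z → x ∣ y → x ∣ y * z
  ∣-*ʳ z x∣y = ∣-respʳ (*-comm z _) (∣-*ˡ z x∣y)

  ∣-+ : ∀ {x y z} → x ∣ y → x ∣ z → x ∣ y + z
  ∣-+ (q , qx≈y) (r , rx≈z) = q + r , trans (distribʳ _ q r) (+-cong qx≈y rx≈z)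

  ∣-neg : ∀ {x y} → x ∣ y → x ∣ - y
  ∣-neg (q , qx≈y) = - q , trans (sym (-‿distribˡ-* q _)) (-‿cong qx≈y)

  ∣-+-cancelˡ : ∀ {x y z} → x ∣ y + z → x ∣ y → x ∣ z
  ∣-+-cancelˡ x∣y+z x∣y = ∣-respʳ (xyx⁻¹≈y _ _) (∣-+ x∣y+z (∣-neg x∣y))

  ∣-*-cong : ∀ {w x y z} → w ∣ x → y ∣ z → w * y ∣ x * z
  ∣-*-cong (q , qw≈x) (r , ry≈z) =
    q * r , trans (interchange q r _ _) (*-cong qw≈x ry≈z)

  record GCD (x y : Carrier) : Set (c ⊔ ℓ) where
    constructor mkGCD
    field
      divisor  : Carrier
      ∣₁       : divisor ∣ x
      ∣₂       : divisor ∣ y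
      greatest : ∀ {e} → e ∣ x → e ∣ y → e ∣ divisor

  GCD-sym : ∀ {x y} → GCD x y → GCD y x
  GCD-sym (mkGCD d d∣x d∣y greatest) = mkGCD d d∣y d∣x λ e∣y e∣x → greatest e∣x e∣y

  GCD-resp-≈ : ∀ {w x y z} → w ≈ x → y ≈ z → GCD w y → GCD x z
  GCD-resp-≈ w≈x y≈z (mkGCD d d∣w d∣y greatest) =
    mkGCD d (∣-respʳ w≈x d∣w) (∣-respʳ y≈z d∣y)
      λ e∣x e∣z → greatest (∣-respʳ (sym w≈x) e∣x) (∣-respʳ (sym y≈z) e∣z)

  record IsGCDDomain : Set (c ⊔ ℓ) where
    field
      1≉0            : 1# ≉ 0#
      zero?          : ∀ x → Dec (x ≈ 0#)
      noZeroDivisors : ∀ {x y} → x * y ≈ 0# → x ≈ 0# ⊎ y ≈ 0#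
      gcd            : ∀ x y → GCD x y

open Divisibility using (mkGCD)

module GCDDomain {c ℓ} (R : CommutativeRing c ℓ)
                 (isGCDDomain : Divisibility.IsGCDDomain R) where

  open CommutativeRing R
  open Divisibility R hiding (mkGCD; GCD-sym; GCD-resp-≈)
  open IsGCDDomain isGCDDomain
  open Algebra.Properties.Ring ring using (x[y-z]≈xy-xz; x∙y⁻¹≈ε⇒x≈y)
  open Algebra.Properties.CommutativeSemigroup *-commutativeSemigroup using (x∙yz≈y∙xz)

  *-≉0 : ∀ {x y} → x ≉ 0# → y ≉ 0# → x * y ≉ 0#
  *-≉0 x≉0 y≉0 xy≈0 with noZeroDivisors xy≈0
  ... | inj₁ x≈0 = x≉0 x≈0
  ... | inj₂ y≈0 = y≉0 y≈0

  *-≉0⇒≉0ˡ : ∀ {x y} → x * y ≉ 0# → x ≉ 0#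
  *-≉0⇒≉0ˡ xy≉0 x≈0 = xy≉0 (trans (*-congʳ x≈0) (zeroˡ _))

  *-≉0⇒≉0ʳ : ∀ {x y} → x * y ≉ 0# → y ≉ 0#
  *-≉0⇒≉0ʳ xy≉0 y≈0 = xy≉0 (trans (*-congˡ y≈0) (zeroʳ _))

  *-cancelˡ : ∀ {x y z} → x ≉ 0# → x * y ≈ x * z → y ≈ z
  *-cancelˡ {x} {y} {z} x≉0 xy≈xz
    with noZeroDivisors (trans (x[y-z]≈xy-xz x y z)
                               (trans (+-congʳ xy≈xz) (-‿inverseʳ _)))
  ... | inj₁ x≈0   = contradiction x≈0 x≉0
  ... | inj₂ y-z≈0 = x∙y⁻¹≈ε⇒x≈y y z y-z≈0

  ∣-cancelˡ : ∀ {x y z} → x ≉ 0# → x * y ∣ x * z → y ∣ z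
  ∣-cancelˡ x≉0 (q , eq) = q , *-cancelˡ x≉0 (trans (x∙yz≈y∙xz _ q _) eq)

  -- A greatest common divisor of xz and yz is a multiple of z, and its cofactor
  -- divides x and y.
  ∣-*-gcd : ∀ {x y z} → (d : GCD x y) → x ∣ y * z → x ∣ GCD.divisor d * z
  ∣-*-gcd {x} {y} {z} (mkGCD d d∣x d∣y greatest) x∣yz with zero? z
  ... | yes z≈0 = ∣-respʳ (sym (trans (*-congˡ z≈0) (zeroʳ d))) (x ∣0)
  ... | no  z≉0 with gcd (z * x) (z * y)
  ...   | mkGCD e e∣zx e∣zy greatestₑ =
    ∣-trans (greatestₑ (∣-*ˡ z ∣-refl) (∣-respʳ (*-comm y z) x∣yz)) e∣dz
    where
    e∣dz : e ∣ d * z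
    e∣dz with greatestₑ (∣-*ʳ x (∣-refl {z})) (∣-*ʳ y ∣-refl)
    ... | u , uz≈e = ∣-respˡ uz≈e (∣-*-cong (greatest (cancel e∣zx) (cancel e∣zy)) ∣-refl)
      where
      cancel : ∀ {w} → e ∣ z * w → u ∣ w
      cancel e∣zw = ∣-cancelˡ z≉0 (∣-respˡ (trans (sym uz≈e) (*-comm u z)) e∣zw)

module PolynomialGCD {c ℓ} (R : CommutativeRing c ℓ)
                     (isGCDDomain : Divisibility.IsGCDDomain R) where

  open CommutativeRing R
  open Divisibility R hiding (mkGCD; GCD-sym; GCD-resp-≈)
  open IsGCDDomain isGCDDomain
  open GCDDomain R isGCDDomain
  open PolynomialRing R
  private
    module P   = CommutativeRing polynomialRing
    module P∣ = Divisibility polynomialRing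
  open P∣ using () renaming (_∣_ to _∣ₚ_)

  •-cong : ∀ {a b f g} → a ≈ b → f ≋ g → a • f ≋ b • g
  •-cong {a} {b} {f} {g} a≈b f≋g = coeffwise λ i →
    trans (coeff-• a f i) (trans (*-cong a≈b (at f≋g i)) (sym (coeff-• b g i)))

  •-assoc : ∀ a b f → (a * b) • f ≋ a • b • f
  •-assoc a b f = coeffwise λ i → trans (coeff-• (a * b) f i)
    (trans (*-assoc a b _) (sym (trans (coeff-• a (b • f) i) (*-congˡ (coeff-• b f i)))))

  •-cancelˡ : ∀ {a f g} → a ≉ 0# → a • f ≋ a • g → f ≋ g
  •-cancelˡ {a} {f} {g} a≉0 af≋ag = coeffwise λ i →
    *-cancelˡ a≉0 (trans (sym (coeff-• a f i)) (trans (at af≋ag i) (coeff-• a g i)))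

  ⊗-congʳ : ∀ {f g} h → f ≋ g → f ⊗ h ≋ g ⊗ h
  ⊗-congʳ h f≋g = ⊗-cong {g = h} f≋g P.refl

  ⊗-congˡ : ∀ {f g} h → f ≋ g → h ⊗ f ≋ h ⊗ g
  ⊗-congˡ h = ⊗-cong {f = h} P.refl

  ⊗-scaleʳ : ∀ a f g → f ⊗ (a • g) ≋ a • (f ⊗ g)
  ⊗-scaleʳ a f g = P.trans (⊗-comm f _) (P.trans (⊗-scaleˡ a g f) (•-cong refl (⊗-comm g f)))

  ⊗-scale : ∀ a b f g → (a • f) ⊗ (b • g) ≋ (a * b) • (f ⊗ g)
  ⊗-scale a b f g = P.trans (⊗-scaleˡ a f (b • g))
    (P.trans (•-cong refl (⊗-scaleʳ b f g)) (P.sym (•-assoc a b (f ⊗ g))))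

  •-∣ : ∀ {a b f g} → a ∣ b → f ∣ₚ g → a • f ∣ₚ b • g
  •-∣ {a} {b} {f} {g} (u , ua≈b) (w , wf≋g) =
    u • w , P.trans (⊗-scale u a w f) (•-cong ua≈b wf≋g)

  coeff-⊗-zero : ∀ f g → coeff (f ⊗ g) 0 ≈ coeff f 0 * coeff g 0
  coeff-⊗-zero f g = trans (coeff-⊗ f g 0) (+-identityʳ _)

  tail-≋ : ∀ {a b f g} → a ∷ f ≋ b ∷ g → f ≋ g
  tail-≋ eq = coeffwise λ i → at eq (suc i)

  ∷-cong : ∀ {a b f g} → a ≈ b → f ≋ g → a ∷ f ≋ b ∷ g
  ∷-cong a≈b f≋g = coeffwise λ { zero → a≈b ; (suc i) → at f≋g i }

  0∷[]≋[] : ∀ {a} → a ≈ 0# → a ∷ [] ≋ []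
  0∷[]≋[] a≈0 = coeffwise λ { zero → a≈0 ; (suc i) → refl }

  ∷-≋[] : ∀ {a f} → a ≈ 0# → f ≋ [] → a ∷ f ≋ []
  ∷-≋[] a≈0 f≋[] = P.trans (∷-cong a≈0 f≋[]) (0∷[]≋[] refl)

  0∷-⊗ : ∀ f g → (0# ∷ f) ⊗ g ≋ 0# ∷ f ⊗ g
  0∷-⊗ f g = P.trans (P.+-congʳ {_} {0# • g} {[]} zero•) P.refl
    where
    zero• : 0# • g ≋ []
    zero• = coeffwise λ i → trans (coeff-• 0# g i) (zeroˡ _)

  ⊗-0∷ : ∀ f g → f ⊗ (0# ∷ g) ≋ 0# ∷ f ⊗ g
  ⊗-0∷ f g = P.trans (⊗-comm f _) (P.trans (0∷-⊗ g f) (∷-cong refl (⊗-comm g f)))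

  ≋[]? : ∀ f → Dec (f ≋ [])
  ≋[]? []      = yes P.refl
  ≋[]? (a ∷ f) with zero? a | ≋[]? f
  ... | yes a≈0 | yes f≋[] = yes (∷-≋[] a≈0 f≋[])
  ... | no  a≉0 | _        = no λ eq → a≉0 (at eq 0)
  ... | _       | no f≉[]  = no λ eq → f≉[] (coeffwise λ i → at eq (suc i))

  0∷-⊗≋[] : ∀ {a} f g → a ≈ 0# → (a ∷ f) ⊗ g ≋ [] → f ⊗ g ≋ []
  0∷-⊗≋[] {a} f g a≈0 eq = tail-≋ {0#} {0#}
    (P.trans (P.sym (0∷-⊗ f g))
      (P.trans (⊗-congʳ g (∷-cong {g = f} (sym a≈0) P.refl)) (P.trans eq (P.sym (0∷[]≋[] refl)))))

  ⊗-noZeroDivisors : ∀ f g → f ⊗ g ≋ [] → f ≋ [] ⊎ g ≋ []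
  ⊗-noZeroDivisors []      _ _ = inj₁ P.refl
  ⊗-noZeroDivisors (a ∷ f)     = go
    where
    go : ∀ g → (a ∷ f) ⊗ g ≋ [] → a ∷ f ≋ [] ⊎ g ≋ []
    go []      _  = inj₂ P.refl
    go (b ∷ g) eq with zero? a | zero? b
    ... | no a≉0  | no b≉0  =
      contradiction (trans (sym (coeff-⊗-zero (a ∷ f) (b ∷ g))) (at eq 0)) (*-≉0 a≉0 b≉0)
    ... | yes a≈0 | _       =
      Sum.map₁ (∷-≋[] a≈0) (⊗-noZeroDivisors f (b ∷ g) (0∷-⊗≋[] f (b ∷ g) a≈0 eq))
    ... | no _    | yes b≈0 =
      Sum.map₂ (∷-≋[] b≈0) (go g (P.trans (⊗-comm (a ∷ f) g)
        (0∷-⊗≋[] g (a ∷ f) b≈0 (P.trans (⊗-comm (b ∷ g) (a ∷ f)) eq))))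

  infix 4 _∣ᶜ_
  _∣ᶜ_ : Carrier → Poly → Set _
  d ∣ᶜ f = ∀ i → d ∣ coeff f i

  -- Content 1 up to units, phrased through divisors. The zero polynomial is excluded: every
  -- constant divides its coefficients, and 0 does not divide 1.
  Primitive : Poly → Set _
  Primitive f = ∀ {e} → e ∣ᶜ f → e ∣ 1#

  ∣ᶜ-• : ∀ {d f g} → f ≋ d • g → d ∣ᶜ f
  ∣ᶜ-• {d} {f} {g} f≋dg i =
    ∣-respʳ (sym (trans (at f≋dg i) (coeff-• d g i))) (∣-*ʳ (coeff g i) ∣-refl)

  ∣ᶜ-resp-≋ : ∀ {d f g} → f ≋ g → d ∣ᶜ f → d ∣ᶜ g
  ∣ᶜ-resp-≋ f≋g d∣f i = ∣-respʳ (at f≋g i) (d∣f i)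

  divide : ∀ {d} f → d ∣ᶜ f → ∃ λ g → length g ≡ length f × f ≋ d • g
  divide []      d∣f = [] , ≡.refl , P.refl
  divide (a ∷ f) d∣f with d∣f 0 | divide f (d∣f ∘ suc)
  ... | q , qd≈a | g , len , f≋dg =
    q ∷ g , ≡.cong suc len , ∷-cong (trans (sym qd≈a) (*-comm q _)) f≋dg

  ∣ᶜ-∣ₚ : ∀ {d f g} → d ∣ᶜ f → f ∣ₚ g → d ∣ᶜ g
  ∣ᶜ-∣ₚ {d} {f} {g} d∣f (w , wf≋g) with divide f d∣f
  ... | f′ , _ , f≋df′ =
    ∣ᶜ-• (P.trans (P.sym wf≋g) (P.trans (⊗-congˡ w f≋df′) (⊗-scaleʳ d w f′)))

  content : ∀ f → ∃ λ d → d ∣ᶜ f × (∀ {e} → e ∣ᶜ f → e ∣ d)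
  content []      = 0# , (λ _ → ∣-refl) , λ {e} _ → e ∣0
  content (a ∷ f) with content f
  ... | d , d∣f , greatest with gcd a d
  ...   | mkGCD d′ d′∣a d′∣d greatest′ =
    d′ , (λ { zero → d′∣a ; (suc i) → ∣-trans d′∣d (d∣f i) }) ,
    λ e∣af → greatest′ (e∣af 0) (greatest (e∣af ∘ suc))

  primitivePart : ∀ f → ¬ f ≋ [] →
    ∃₂ λ d g → d ≉ 0# × length g ≡ length f × f ≋ d • g × Primitive g
  primitivePart f f≉[] with content f
  ... | d , d∣f , greatest with divide f d∣f
  ...   | g , len , f≋dg = d , g , d≉0 , len , f≋dg , primᵍ
    where
    d≉0 : d ≉ 0#
    d≉0 d≈0 = f≉[] (P.trans f≋dg (coeffwise λ i →
      trans (coeff-• d g i) (trans (*-congʳ d≈0) (zeroˡ _))))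
    primᵍ : Primitive g
    primᵍ {e} e∣g = ∣-cancelˡ d≉0 (∣-respʳ (sym (*-identityʳ d)) (greatest λ i →
      ∣-respʳ (sym (trans (at f≋dg i) (coeff-• d g i))) (∣-*-cong ∣-refl (e∣g i))))

  -- The content of `a • f` is a multiple u a of a. Cancelling a, u divides every coefficient of f
  -- and is a unit, so the content, and d with it, divides a.
  ∣ᶜ-•-primitive : ∀ {a d f} → Primitive f → d ∣ᶜ (a • f) → d ∣ a
  ∣ᶜ-•-primitive {a} {d} {f} prim d∣af with zero? a | content (a • f)
  ... | yes a≈0 | _ = ∣-respʳ (sym a≈0) (d ∣0)
  ... | no  a≉0 | e , e∣af , greatest with greatest (∣ᶜ-• {a} {a • f} {f} P.refl)
  ...   | u , ua≈e = ∣-trans (greatest d∣af) (∣-respˡ ua≈e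
          (∣-respʳ (*-identityˡ a) (∣-*-cong (prim λ i → ∣-cancelˡ a≉0
            (∣-respˡ (trans (sym ua≈e) (*-comm u a)) (∣-respʳ (coeff-• a f i) (e∣af i)))) ∣-refl)))

  -- A divisor of (a + x f) g and of a divides f g, hence f by the primitivity of the
  -- primitive parts, hence a + x f.
  primitive-⊗-constant : ∀ {a d e f g} →
    (∀ h → length h ≡ length f → Primitive h → Primitive (h ⊗ g)) →
    Primitive (a ∷ f) → d ∣ᶜ ((a ∷ f) ⊗ g) → e ∣ d → e ∣ a → e ∣ 1#
  primitive-⊗-constant {a} {d} {e} {f} {g} rec prim d∣fg e∣d e∣a =
    prim λ { zero → e∣a ; (suc i) → e∣f i }
    where
    e∣f⊗g : e ∣ᶜ (f ⊗ g)
    e∣f⊗g i = ∣-+-cancelˡ (∣-respʳ (coeff-⊕ (a • g) (0# ∷ f ⊗ g) (suc i)) (∣-trans e∣d (d∣fg (suc i))))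
                          (∣-respʳ (sym (coeff-• a g (suc i))) (∣-*ʳ _ e∣a))
    e∣f : e ∣ᶜ f
    e∣f with ≋[]? f
    ... | yes f≋[] = λ i → ∣-respʳ (sym (at f≋[] i)) (e ∣0)
    ... | no  f≉[] with primitivePart f f≉[]
    ...   | b , h , _ , len , f≋bh , primₕ = λ i → ∣-respʳ
              (sym (trans (at f≋bh i) (coeff-• b h i)))
              (∣-*ʳ _ (∣ᶜ-•-primitive {b} {e} {h ⊗ g} (rec h len primₕ)
                (∣ᶜ-resp-≋ (P.trans (⊗-congʳ g f≋bh) (⊗-scaleˡ b h g)) e∣f⊗g)))

  -- Gauss's lemma with gcds in the role of prime elements. If d divides the product, then d divides
  -- a b, the constant coefficient. The gcd of d and a is a unit by `primitive-⊗-constant`, hence d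
  -- divides b; the same lemma with the factors exchanged makes d itself a unit.
  primitive-⊗ : ∀ n f g → length f ℕ.+ length g ≤ n →
                Primitive f → Primitive g → Primitive (f ⊗ g)
  primitive-⊗ n       []      g       _         primᶠ _     {e} _ = primᶠ λ i → e ∣0
  primitive-⊗ n       (a ∷ f) []      _         _     primᵍ {e} _ = primᵍ λ i → e ∣0
  primitive-⊗ (suc n) (a ∷ f) (b ∷ g) (s≤s len) primᶠ primᵍ {d} d∣fg =
    primitive-⊗-constant recᵍ primᵍ (∣ᶜ-resp-≋ (⊗-comm (a ∷ f) (b ∷ g)) d∣fg) ∣-refl d∣b
    where
    recᶠ : ∀ h → length h ≡ length f → Primitive h → Primitive (h ⊗ (b ∷ g))
    recᶠ h eq primₕ = primitive-⊗ n h (b ∷ g)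
      (≡.subst (λ l → l ℕ.+ suc (length g) ≤ n) (≡.sym eq) len) primₕ primᵍ
    recᵍ : ∀ h → length h ≡ length g → Primitive h → Primitive (h ⊗ (a ∷ f))
    recᵍ h eq primₕ = primitive-⊗ n h (a ∷ f)
      (≡.subst (λ l → l ℕ.+ suc (length f) ≤ n) (≡.sym eq)
        (ℕ.≤-trans (ℕ.≤-reflexive (≡.trans (ℕ.+-comm (length g) _) (≡.sym (ℕ.+-suc (length f) _)))) len))
      primₕ primᶠ
    d∣1*b : GCD.divisor (gcd d a) * b ∣ b
    d∣1*b = ∣-respʳ (*-identityˡ b) (∣-*-cong
      (primitive-⊗-constant recᶠ primᶠ d∣fg (GCD.∣₁ (gcd d a)) (GCD.∣₂ (gcd d a))) ∣-refl)
    d∣b : d ∣ b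
    d∣b = ∣-trans (∣-*-gcd (gcd d a) (∣-respʳ (coeff-⊗-zero (a ∷ f) (b ∷ g)) (d∣fg 0))) d∣1*b

  primitive-∣ : ∀ {f g} → f ∣ₚ g → Primitive g → Primitive f
  primitive-∣ f∣g primᵍ e∣f = primᵍ (∣ᶜ-∣ₚ e∣f f∣g)

  -- Let w h = a f and w = b v with v primitive. Then v h is primitive by Gauss's lemma, so a
  -- divides b and can be cancelled from the cofactor. The zero cofactor has no primitive part and
  -- is treated apart.
  primitive-∣-• : ∀ {a f} h → Primitive h → a ≉ 0# → h ∣ₚ a • f → h ∣ₚ f
  primitive-∣-• {a} {f} h primₕ a≉0 (w , wh≋af) with ≋[]? w
  ... | yes w≋[] = P∣.∣-respʳ (P.sym f≋[]) (h P∣.∣0)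
    where
    f≋[] : f ≋ []
    f≋[] = •-cancelˡ {a} {f} {[]} a≉0 (P.trans (P.sym wh≋af) (⊗-congʳ h w≋[]))
  ... | no w≉[] with primitivePart w w≉[]
  ...   | b , v , _ , _ , w≋bv , primᵥ
          with ∣ᶜ-•-primitive {b} {a} {v ⊗ h} (primitive-⊗ _ v h ℕ.≤-refl primᵥ primₕ)
                 (∣ᶜ-• {a} {b • (v ⊗ h)} {f} (P.trans (P.sym (P.trans (⊗-congʳ h w≋bv) (⊗-scaleˡ b v h))) wh≋af))
  ...     | u , ua≈b = u • v , P.trans (⊗-scaleˡ u v h) (•-cancelˡ {a} a≉0
              (P.trans (P.sym (•-assoc a u (v ⊗ h))) (P.trans (•-cong (trans (*-comm a u) ua≈b) P.refl)
                (P.trans (P.sym (P.trans (⊗-congʳ h w≋bv) (⊗-scaleˡ b v h))) wh≋af))))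

  -- Gcds of polynomials, by elimination of constant coefficients

  open P∣ using (GCD-sym; GCD-resp-≈) renaming (GCD to GCDₚ)

  ∣ₚ-constant-≉0 : ∀ {e f} → e ∣ₚ f → coeff f 0 ≉ 0# → coeff e 0 ≉ 0#
  ∣ₚ-constant-≉0 {e} (w , we≋f) f₀≉0 =
    *-≉0⇒≉0ʳ {coeff w 0} λ eq → f₀≉0 (trans (sym (at we≋f 0)) (trans (coeff-⊗-zero w e) eq))

  -- Here `0# ∷ f` is x f. Since e has a nonzero constant coefficient, that of the cofactor must
  -- vanish, and x can be cancelled.
  ∣ₚ-0∷ : ∀ {e f} → coeff e 0 ≉ 0# → e ∣ₚ (0# ∷ f) → e ∣ₚ f
  ∣ₚ-0∷ {e} e₀≉0 ([]    , eq) = [] , tail-≋ {0#} (P.trans (0∷[]≋[] refl) eq)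
  ∣ₚ-0∷ {e} e₀≉0 (b ∷ w , eq) with noZeroDivisors (trans (sym (coeff-⊗-zero (b ∷ w) e)) (at eq 0))
  ... | inj₁ b≈0  = w , tail-≋ {0#} (P.trans (P.sym (0∷-⊗ w e)) (P.trans (⊗-congʳ e (∷-cong {g = w} (sym b≈0) P.refl)) eq))
  ... | inj₂ e₀≈0 = contradiction e₀≈0 e₀≉0

  0∷-∣ₚ : ∀ {e f} → e ∣ₚ f → e ∣ₚ (0# ∷ f)
  0∷-∣ₚ {e} (w , we≋f) = 0# ∷ w , P.trans (0∷-⊗ w e) (∷-cong refl we≋f)

  0∷-∣ₚ-0∷ : ∀ {e f} → e ∣ₚ f → (0# ∷ e) ∣ₚ (0# ∷ f)
  0∷-∣ₚ-0∷ {e} (w , we≋f) = w , P.trans (⊗-0∷ w e) (∷-cong refl we≋f)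

  0∷-∣ₚ-0∷⁻¹ : ∀ {e f} → (0# ∷ e) ∣ₚ (0# ∷ f) → e ∣ₚ f
  0∷-∣ₚ-0∷⁻¹ {e} (w , eq) = w , tail-≋ {0#} (P.trans (P.sym (⊗-0∷ w e)) eq)

  -- A common divisor of x f and x g either has a nonzero constant coefficient and divides f and g,
  -- or it is x times a common divisor of f and g.
  gcd-0∷ : ∀ {f g} → GCDₚ f g → GCDₚ (0# ∷ f) (0# ∷ g)
  gcd-0∷ {f} {g} (mkGCD d d∣f d∣g greatest) =
    mkGCD (0# ∷ d) (0∷-∣ₚ-0∷ d∣f) (0∷-∣ₚ-0∷ d∣g) greatest′
    where
    greatest′ : ∀ {e} → e ∣ₚ (0# ∷ f) → e ∣ₚ (0# ∷ g) → e ∣ₚ (0# ∷ d)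
    greatest′ {e} e∣f e∣g with zero? (coeff e 0)
    ... | no  e₀≉0 = 0∷-∣ₚ (greatest (∣ₚ-0∷ e₀≉0 e∣f) (∣ₚ-0∷ e₀≉0 e∣g))
    ... | yes e₀≈0 = P∣.∣-respˡ (P.sym e≋)
            (0∷-∣ₚ-0∷ (greatest (0∷-∣ₚ-0∷⁻¹ (P∣.∣-respˡ e≋ e∣f)) (0∷-∣ₚ-0∷⁻¹ (P∣.∣-respˡ e≋ e∣g))))
      where
      shift : ∀ e → coeff e 0 ≈ 0# → e ≋ 0# ∷ List.drop 1 e
      shift []      _   = P.sym (0∷[]≋[] refl)
      shift (a ∷ e) a≈0 = ∷-cong a≈0 P.refl
      e≋ : e ≋ 0# ∷ List.drop 1 e
      e≋ = shift e e₀≈0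

  gcd-0∷ˡ : ∀ {f g} → coeff g 0 ≉ 0# → GCDₚ f g → GCDₚ (0# ∷ f) g
  gcd-0∷ˡ g₀≉0 (mkGCD d d∣f d∣g greatest) =
    mkGCD d (0∷-∣ₚ d∣f) d∣g λ e∣f e∣g → greatest (∣ₚ-0∷ (∣ₚ-constant-≉0 e∣g g₀≉0) e∣f) e∣g

  -- Contents and primitive parts can be treated separately: if e = v e′ with e′ primitive divides
  -- `a • f` and `b • g`, then v divides a and b, and e′ divides f and g.
  gcd-• : ∀ {a b f g} → a ≉ 0# → b ≉ 0# → ¬ a • f ≋ [] → Primitive f → Primitive g →
          GCDₚ f g → GCDₚ (a • f) (b • g)
  gcd-• {a} {b} {f} {g} a≉0 b≉0 af≉[] primᶠ primᵍ (mkGCD d d∣f d∣g greatest) with gcd a b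
  ... | mkGCD s s∣a s∣b greatestₛ = mkGCD (s • d) (•-∣ s∣a d∣f) (•-∣ s∣b d∣g) greatest′
    where
    greatest′ : ∀ {e} → e ∣ₚ a • f → e ∣ₚ b • g → e ∣ₚ s • d
    greatest′ {e} e∣af e∣bg with ≋[]? e
    ... | yes e≋[] = contradiction (P∣.0∣x⇒x≈0 (P∣.∣-respˡ e≋[] e∣af)) af≉[]
    ... | no  e≉[] with primitivePart e e≉[]
    ...   | v , e′ , _ , _ , e≋ve′ , prim = P∣.∣-respˡ (P.sym e≋ve′)
              (•-∣ (greatestₛ (v∣ primᶠ e∣af) (v∣ primᵍ e∣bg)) (greatest (e′∣ a≉0 e∣af) (e′∣ b≉0 e∣bg)))
      where
      v∣ : ∀ {x h} → Primitive h → e ∣ₚ x • h → v ∣ x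
      v∣ {x} {h} primₕ e∣xh = ∣ᶜ-•-primitive {x} {v} {h} primₕ (∣ᶜ-∣ₚ (∣ᶜ-• {v} {e} {e′} e≋ve′) e∣xh)
      e′∣ : ∀ {x h} → x ≉ 0# → e ∣ₚ x • h → e′ ∣ₚ h
      e′∣ x≉0 e∣xh = primitive-∣-• e′ prim x≉0 (P∣.∣-trans
        (v • (1# ∷ []) , P.trans (⊗-scaleˡ v (1# ∷ []) e′) (P.trans (•-cong refl (⊗-identityˡ e′)) (P.sym e≋ve′))) e∣xh)

  -- A Euclidean step at the constant terms: x r = b f - a g, and x is coprime
  -- to g.
  gcd-step : ∀ {a b f g} → a ≉ 0# → b ≉ 0# → Primitive (a ∷ f) → Primitive (b ∷ g) →
             GCDₚ (b • f ⊕ ⊖ (a • g)) (b ∷ g) → GCDₚ (a ∷ f) (b ∷ g)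
  gcd-step {a} {b} {f} {g} a≉0 b≉0 primᶠ primᵍ (mkGCD d d∣r d∣g greatest) =
    mkGCD d (primitive-∣-• d (primitive-∣ d∣g primᵍ) b≉0
              (P∣.∣-+-cancelˡ (P∣.∣-respʳ (P.trans xr≋ (P.+-comm (b • (a ∷ f)) (⊖ (a • (b ∷ g))))) (0∷-∣ₚ d∣r))
                              (P∣.∣-neg (∣-•ʳ a d∣g))))
          d∣g
          (λ e∣f e∣g → greatest (∣ₚ-0∷ (∣ₚ-constant-≉0 e∣g b≉0)
            (P∣.∣-respʳ (P.sym xr≋) (P∣.∣-+ (∣-•ʳ b e∣f) (P∣.∣-neg (∣-•ʳ a e∣g))))) e∣g)
    where
    ∣-•ʳ : ∀ s {e h} → e ∣ₚ h → e ∣ₚ s • h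
    ∣-•ʳ s {e} (w , we≋h) = s • w , P.trans (⊗-scaleˡ s w e) (•-cong refl we≋h)
    xr≋ : 0# ∷ (b • f ⊕ ⊖ (a • g)) ≋ b • (a ∷ f) ⊕ ⊖ (a • (b ∷ g))
    xr≋ = ∷-cong (sym (trans (+-congʳ (*-comm b a)) (-‿inverseʳ _))) P.refl

  length-⊕ : ∀ {n} f g → length f ≤ n → length g ≤ n → length (f ⊕ g) ≤ n
  length-⊕ []      g       _         len       = len
  length-⊕ (a ∷ f) []      len       _         = len
  length-⊕ (a ∷ f) (b ∷ g) (s≤s len) (s≤s len′) = s≤s (length-⊕ f g len len′)

  -- Elimination starts at the constant coefficient because that is the head of the list, whereas
  -- trailing zeros may hide the leading one. The total length drops in every case: a vanishing
  -- constant coefficient is removed, and two nonzero ones are eliminated against each other after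
  -- passing to primitive parts.
  gcdₚ : ∀ n f g → length f ℕ.+ length g ≤ n → GCDₚ f g
  gcdₚ n       []      g       len = mkGCD g (g P∣.∣0) P∣.∣-refl λ _ e∣g → e∣g
  gcdₚ n       (a ∷ f) []      len = mkGCD (a ∷ f) P∣.∣-refl ((a ∷ f) P∣.∣0) λ e∣f _ → e∣f
  gcdₚ (suc n) (a ∷ f) (b ∷ g) (s≤s len) with zero? a | zero? b
  ... | yes a≈0 | yes b≈0 = GCD-resp-≈ (∷-cong (sym a≈0) P.refl) (∷-cong (sym b≈0) P.refl)
          (gcd-0∷ (gcdₚ n f g (ℕ.≤-trans (ℕ.+-monoʳ-≤ (length f) (ℕ.n≤1+n _)) len)))
  ... | yes a≈0 | no  b≉0 = GCD-resp-≈ (∷-cong (sym a≈0) P.refl) P.refl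
          (gcd-0∷ˡ b≉0 (gcdₚ n f (b ∷ g) len))
  ... | no  a≉0 | yes b≈0 = GCD-resp-≈ P.refl (∷-cong (sym b≈0) P.refl)
          (GCD-sym (gcd-0∷ˡ a≉0 (gcdₚ n g (a ∷ f) (ℕ.≤-trans
            (ℕ.≤-reflexive (≡.trans (ℕ.+-comm (length g) _) (≡.sym (ℕ.+-suc (length f) _)))) len))))
  ... | no  a≉0 | no  b≉0
        with primitivePart (a ∷ f) (λ eq → a≉0 (at eq 0)) | primitivePart (b ∷ g) (λ eq → b≉0 (at eq 0))
  ...   | s , a′ ∷ f′ , s≉0 , lenᶠ , f≋ , primᶠ | t , b′ ∷ g′ , t≉0 , lenᵍ , g≋ , primᵍ =
    GCD-resp-≈ (P.sym f≋) (P.sym g≋) (gcd-• s≉0 t≉0 (λ eq → a≉0 (trans (at f≋ 0) (at eq 0))) primᶠ primᵍ gcd′)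
    where
    a′≉0 : a′ ≉ 0#
    a′≉0 = *-≉0⇒≉0ʳ {s} λ eq → a≉0 (trans (at f≋ 0) eq)
    b′≉0 : b′ ≉ 0#
    b′≉0 = *-≉0⇒≉0ʳ {t} λ eq → b≉0 (trans (at g≋ 0) eq)
    lenᶠ′ : length f′ ≡ length f
    lenᶠ′ = ℕ.suc-injective lenᶠ
    lenᵍ′ : length g′ ≡ length g
    lenᵍ′ = ℕ.suc-injective lenᵍ
    bound : ∀ x h y k → length k ≤ length h → length (x • h ⊕ ⊖ (y • k)) ≤ length h
    bound x h y k k≤h = length-⊕ (x • h) (⊖ (y • k)) (ℕ.≤-reflexive (length-map _ h))
      (ℕ.≤-trans (ℕ.≤-reflexive (≡.trans (length-map _ (y • k)) (length-map _ k))) k≤h)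
    len′ : length f′ ℕ.+ suc (length g′) ≤ n
    len′ = ≡.subst₂ (λ x y → x ℕ.+ suc y ≤ n) (≡.sym lenᶠ′) (≡.sym lenᵍ′) len
    gcd′ : GCDₚ (a′ ∷ f′) (b′ ∷ g′)
    -- The longer polynomial is the one reduced, so that the combination of the two tails is no
    -- longer than the tail it replaces.
    gcd′ with ℕ.≤-total (length g′) (length f′)
    ... | inj₁ g≤f = gcd-step a′≉0 b′≉0 primᶠ primᵍ (gcdₚ n _ (b′ ∷ g′)
            (ℕ.≤-trans (ℕ.+-monoˡ-≤ (suc (length g′)) (bound b′ f′ a′ g′ g≤f)) len′))
    ... | inj₂ f≤g = GCD-sym (gcd-step b′≉0 a′≉0 primᵍ primᶠ (gcdₚ n _ (a′ ∷ f′)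
            (ℕ.≤-trans (ℕ.+-monoˡ-≤ (suc (length f′)) (bound a′ g′ b′ f′ f≤g))
              (ℕ.≤-trans (ℕ.≤-reflexive (≡.trans (ℕ.+-suc (length g′) _)
                (≡.trans (≡.cong suc (ℕ.+-comm (length g′) _)) (≡.sym (ℕ.+-suc (length f′) _))))) len′))))

  polynomial-isGCDDomain : P∣.IsGCDDomain
  polynomial-isGCDDomain = record
    { 1≉0            = λ eq → 1≉0 (at eq 0)
    ; zero?          = ≋[]?
    ; noZeroDivisors = λ {f} {g} → ⊗-noZeroDivisors f g
    ; gcd            = λ f g → gcdₚ _ f g ℕ.≤-refl
    }

-- Polynomials in several variables

module IteratedPolynomials {c ℓ q} (F : FiniteField c ℓ q) where

  open FiniteField F

  ≈? : ∀ x y → Dec (x ≈ y)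
  ≈? x y = map′ (λ eq → trans (sym (strictlyInverseʳ x)) (trans (from-cong eq) (strictlyInverseʳ y)))
                to-cong (to x Fin.≟ to y)
    where open Inverse cardinality

  inverseˡ : ∀ x → x ≉ 0# → ∃ λ y → y * x ≈ 1#
  inverseˡ x x≉0 with inverse x x≉0
  ... | y , xy≈1 = y , trans (*-comm y x) xy≈1

  field-noZeroDivisors : ∀ {x y} → x * y ≈ 0# → x ≈ 0# ⊎ y ≈ 0#
  field-noZeroDivisors {x} {y} xy≈0 with ≈? x 0#
  ... | yes x≈0 = inj₁ x≈0
  ... | no  x≉0 with inverseˡ x x≉0
  ...   | z , zx≈1 = inj₂ (begin
    y           ≈⟨ *-identityˡ y ⟨
    1# * y      ≈⟨ *-congʳ zx≈1 ⟨
    z * x * y   ≈⟨ *-assoc z x y ⟩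
    z * (x * y) ≈⟨ *-congˡ xy≈0 ⟩
    z * 0#      ≈⟨ zeroʳ z ⟩
    0#          ∎)
    where open Relation.Binary.Reasoning.Setoid setoid

  field-isGCDDomain : Divisibility.IsGCDDomain commutativeRing
  field-isGCDDomain = record
    { 1≉0            = 1≉0
    ; zero?          = λ x → ≈? x 0#
    ; noZeroDivisors = field-noZeroDivisors
    ; gcd            = gcd
    }
    where
    open Divisibility commutativeRing hiding (mkGCD)
    gcd : ∀ x y → GCD x y
    gcd x y with ≈? x 0#
    ... | yes x≈0 = mkGCD y (∣-respʳ (sym x≈0) (y ∣0)) ∣-refl λ _ e∣y → e∣y
    ... | no  x≉0 with inverseˡ x x≉0
    ...   | z , zx≈1 = mkGCD x ∣-refl (∣-trans (z , zx≈1) (1∣ y)) λ e∣x _ → e∣x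

  Ring : ℕ → CommutativeRing c ℓ
  Ring zero    = commutativeRing
  Ring (suc n) = PolynomialRing.polynomialRing (Ring n)

  ring-isGCDDomain : ∀ n → Divisibility.IsGCDDomain (Ring n)
  ring-isGCDDomain zero    = field-isGCDDomain
  ring-isGCDDomain (suc n) = PolynomialGCD.polynomial-isGCDDomain (Ring n) (ring-isGCDDomain n)

  private
    module R n = CommutativeRing (Ring n)
    module P n = PolynomialRing (Ring n)

  coefficient : ∀ n → R.Carrier n → Monomial n → Carrier
  coefficient zero    a []      = a
  coefficient (suc n) f (e ∷ μ) = coefficient n (P.coeff n f e) μ

  coefficient-cong : ∀ n {f g} → R._≈_ n f g → ∀ μ → coefficient n f μ ≈ coefficient n g μ
  coefficient-cong zero    f≈g []      = f≈g
  coefficient-cong (suc n) f≈g (e ∷ μ) = coefficient-cong n (P.at {n} f≈g e) μ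

  coefficient-injective : ∀ n {f g} → (∀ μ → coefficient n f μ ≈ coefficient n g μ) → R._≈_ n f g
  coefficient-injective zero    eq = eq []
  coefficient-injective (suc n) eq =
    P.coeffwise {n} λ e → coefficient-injective n λ μ → eq (e ∷ μ)

  coefficient-0# : ∀ n μ → coefficient n (R.0# n) μ ≈ 0#
  coefficient-0# zero    []      = refl
  coefficient-0# (suc n) (e ∷ μ) = coefficient-0# n μ

  coefficient-+ : ∀ n f g μ → coefficient n (R._+_ n f g) μ ≈ coefficient n f μ + coefficient n g μ
  coefficient-+ zero    f g []      = refl
  coefficient-+ (suc n) f g (e ∷ μ) = trans (coefficient-cong n (P.coeff-⊕ n f g e) μ)
                                            (coefficient-+ n (P.coeff n f e) (P.coeff n g e) μ)

  open Algebra.Properties.Semiring.Sum semiring using (sum; sum-cong-≋)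

  coefficient-sum : ∀ n {m} (f : Fin m → R.Carrier n) μ →
    coefficient n (Algebra.Properties.Semiring.Sum.sum (R.semiring n) f) μ ≈
    sum (λ i → coefficient n (f i) μ)
  coefficient-sum n {zero}  f μ = coefficient-0# n μ
  coefficient-sum n {suc m} f μ =
    trans (coefficient-+ n _ _ μ) (+-congˡ (coefficient-sum n (f ∘ suc) μ))

  constants : ∀ n → Carrier → R.Carrier n
  constants zero    a = a
  constants (suc n) a = constants n a ∷ []

  coefficient-constants-* : ∀ n a f μ →
    coefficient n (R._*_ n (constants n a) f) μ ≈ a * coefficient n f μ
  coefficient-constants-* zero    a f []      = refl
  coefficient-constants-* (suc n) a f (e ∷ μ) =
    trans (coefficient-cong n (coeff-* e) μ) (coefficient-constants-* n a (P.coeff n f e) μ)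
    where
    open CauchyProduct (Ring n) using (⊛-zeroˡ)
    open R n using () renaming (_≈_ to _≈ₙ_; _*_ to _*ₙ_)
    coeff-* : ∀ e → P.coeff n (R._*_ (suc n) (constants (suc n) a) f) e ≈ₙ (constants n a *ₙ P.coeff n f e)
    coeff-* zero    = R.trans n (P.coeff-⊗ n (constants (suc n) a) f 0) (R.+-identityʳ n _)
    coeff-* (suc e) = R.trans n (P.coeff-⊗ n (constants (suc n) a) f (suc e))
      (R.trans n (R.+-congˡ n (⊛-zeroˡ (P.coeff n f) (λ _ → R.refl n) e)) (R.+-identityʳ n _))

  coefficient-1# : ∀ n → coefficient n (R.1# n) (Vec.replicate n 0) ≈ 1#
  coefficient-1# zero    = refl
  coefficient-1# (suc n) = coefficient-1# n

  coefficient-1#-0 : ∀ n μ → 0 < ∣ μ ∣ₘ → coefficient n (R.1# n) μ ≈ 0#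
  coefficient-1#-0 (suc n) (zero  ∷ μ) 0<μ = coefficient-1#-0 n μ 0<μ
  coefficient-1#-0 (suc n) (suc e ∷ μ) 0<μ = coefficient-0# n μ

  ∣∣ₘ≡0 : ∀ {n} (μ : Monomial n) → ∣ μ ∣ₘ ≡ 0 → μ ≡ Vec.replicate n 0
  ∣∣ₘ≡0 []         _  = ≡.refl
  ∣∣ₘ≡0 (zero ∷ μ) eq = ≡.cong (0 ∷_) (∣∣ₘ≡0 μ eq)

  -- Stronger than decidability of being zero: the monomial found is the kind of witness that
  -- `HasDegree` asks for.
  zero-or-coefficient : ∀ n f → R._≈_ n f (R.0# n) ⊎ ∃ λ μ → coefficient n f μ ≉ 0#
  zero-or-coefficient zero    a with ≈? a 0#
  ... | yes a≈0 = inj₁ a≈0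
  ... | no  a≉0 = inj₂ ([] , a≉0)
  zero-or-coefficient (suc n) []      = inj₁ (R.refl (suc n))
  zero-or-coefficient (suc n) (a ∷ f) with zero-or-coefficient n a | zero-or-coefficient (suc n) f
  ... | inj₂ (μ , a≉0) | _                    = inj₂ (0 ∷ μ , a≉0)
  ... | inj₁ _         | inj₂ (e ∷ μ , f≉0)   = inj₂ (suc e ∷ μ , f≉0)
  ... | inj₁ a≈0       | inj₁ f≈0             =
    inj₁ (P.coeffwise {n} λ { zero → a≈0 ; (suc i) → P.at {n} f≈0 i })

  -- Every variable gets the exponents 0 to d: this cube contains all monomials of total degree at
  -- most d, and beyond them f is assumed to vanish where the function is used.
  fromCoefficients : ∀ n → ℕ → (Monomial n → Carrier) → R.Carrier n
  fromCoefficients zero    d f = f []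
  fromCoefficients (suc n) d f = applyUpTo (λ e → fromCoefficients n d (λ μ → f (e ∷ μ))) (suc d)

  coefficient-fromCoefficients : ∀ n d f → (∀ μ → d < ∣ μ ∣ₘ → f μ ≈ 0#) →
    ∀ μ → coefficient n (fromCoefficients n d f) μ ≈ f μ
  coefficient-fromCoefficients zero    d f f≈0 []      = refl
  coefficient-fromCoefficients (suc n) d f f≈0 (e ∷ μ) with e ℕ.<? suc d
  ... | yes e<d = trans (reflexive (≡.cong (λ g → coefficient n g μ) (coeff-applyUpTo (λ e → fromCoefficients n d (λ μ → f (e ∷ μ))) e<d)))
                        (coefficient-fromCoefficients n d (λ ν → f (e ∷ ν))
                          (λ ν d<ν → f≈0 (e ∷ ν) (ℕ.≤-trans d<ν (ℕ.m≤n+m _ e))) μ)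
    where
    coeff-applyUpTo : ∀ h {m i} → i < m → P.coeff n (applyUpTo h m) i ≡ h i
    coeff-applyUpTo h {suc m} {zero}  _         = ≡.refl
    coeff-applyUpTo h {suc m} {suc i} (s≤s i<m) = coeff-applyUpTo (h ∘ suc) i<m
  ... | no  e≮d = trans (reflexive (≡.cong (λ g → coefficient n g μ) (coeff-applyUpTo (λ e → fromCoefficients n d (λ μ → f (e ∷ μ))) (ℕ.≮⇒≥ e≮d))))
                        (trans (coefficient-0# n μ) (sym (f≈0 (e ∷ μ) (ℕ.≤-trans (ℕ.≮⇒≥ e≮d) (ℕ.m≤m+n e _)))))
    where
    coeff-applyUpTo : ∀ h {m i} → m ≤ i → P.coeff n (applyUpTo h m) i ≡ R.0# n
    coeff-applyUpTo h {zero}          _         = ≡.refl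
    coeff-applyUpTo h {suc m} {suc i} (s≤s m≤i) = coeff-applyUpTo (h ∘ suc) m≤i

  degreeBound : ∀ n f → ∃ λ d → ∀ μ → d < ∣ μ ∣ₘ → coefficient n f μ ≈ 0#
  degreeBound zero    a       = 0 , λ { [] () }
  degreeBound (suc n) []      = 0 , λ { (e ∷ μ) _ → coefficient-0# n μ }
  degreeBound (suc n) (a ∷ f) with degreeBound n a | degreeBound (suc n) f
  ... | d , a≈0 | d′ , f≈0 = d ℕ.⊔ suc d′ , λ
    { (zero  ∷ μ) lt → a≈0 μ (ℕ.≤-<-trans (ℕ.m≤m⊔n d _) lt)
    ; (suc e ∷ μ) lt → f≈0 (e ∷ μ) (ℕ.≤-pred (ℕ.≤-<-trans (ℕ.m≤n⊔m d _) lt)) }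

-- Total degree and the passage between the two models of polynomials

module TotalDegree {c ℓ q} (F : FiniteField c ℓ q) (k : ℕ) where

  open FiniteField F
  open IteratedPolynomials F
  open Polynomials F k
  open Algebra.Properties.Semiring.Sum semiring using (sum-cong-≋)
  open Relation.Binary.Reasoning.Setoid setoid

  -- The hypothesis is restricted to pairs of the right total size; `Deg-*` compares products that
  -- agree only in the top degree.
  convolution-cong : ∀ {n} f f′ g g′ (μ : Monomial n) →
    (∀ ν ρ → ∣ ν ∣ₘ ℕ.+ ∣ ρ ∣ₘ ≡ ∣ μ ∣ₘ → f ν * g ρ ≈ f′ ν * g′ ρ) →
    convolution f g μ ≈ convolution f′ g′ μ
  convolution-cong f f′ g g′ []      eq = eq [] [] ≡.refl
  convolution-cong f f′ g g′ (e ∷ μ) eq = sum-cong-≋ {suc e} λ i →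
    convolution-cong _ _ _ _ μ λ ν ρ size → eq (toℕ i ∷ ν) (e ∸ toℕ i ∷ ρ)
      (≡.trans (interchange (toℕ i) _ (e ∸ toℕ i) _)
        (≡.cong₂ ℕ._+_ (ℕ.m+[n∸m]≡n (ℕ.≤-pred (Fin.toℕ<n i))) size))
    where open Algebra.Properties.CommutativeSemigroup ℕ.+-commutativeSemigroup using (interchange)

  coefficient-* : ∀ n f g μ →
    coefficient n (CommutativeRing._*_ (Ring n) f g) μ ≈
    convolution (coefficient n f) (coefficient n g) μ
  coefficient-* zero    f g []      = refl
  coefficient-* (suc n) f g (e ∷ μ) =
    trans (coefficient-cong n (PolynomialRing.coeff-⊗ (Ring n) f g e) μ)
      (trans (coefficient-sum n {suc e} (λ i → coeffₙ f (toℕ i) *ₙ coeffₙ g (e ∸ toℕ i)) μ)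
        (sum-cong-≋ {suc e} λ i → coefficient-* n (coeffₙ f (toℕ i)) (coeffₙ g (e ∸ toℕ i)) μ))
    where
    open CommutativeRing (Ring n) using () renaming (_*_ to _*ₙ_)
    open PolynomialRing (Ring n) using () renaming (coeff to coeffₙ)

  A : CommutativeRing c ℓ
  A = Ring k

  module A = CommutativeRing A
  open Divisibility A renaming (Irreducible to Irreducibleᴬ)
  open GCDDomain A (ring-isGCDDomain k)

  toPolynomial : A.Carrier → Polynomial
  toPolynomial f = mkPolynomial (coefficient k f) (degreeBound k f)

  fromPolynomial : Polynomial → A.Carrier
  fromPolynomial (mkPolynomial f (d , _)) = fromCoefficients k d f

  coefficient-fromPolynomial : ∀ f μ → coefficient k (fromPolynomial f) μ ≈ coeff f μ
  coefficient-fromPolynomial (mkPolynomial f (d , f≈0)) = coefficient-fromCoefficients k d f f≈0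

  Deg : A.Carrier → ℕ → Set ℓ
  Deg f = HasDegree (toPolynomial f)

  HasDegree-resp : ∀ {f g m} → f ≈ₚ g → HasDegree f m → HasDegree g m
  HasDegree-resp f≈g ((μ , μ≡m , f≉0) , f≈0) =
    (μ , μ≡m , λ g≈0 → f≉0 (trans (f≈g μ) g≈0)) , λ ν m<ν → trans (sym (f≈g ν)) (f≈0 ν m<ν)

  Deg-cong : ∀ {f g m} → f A.≈ g → Deg f m → Deg g m
  Deg-cong f≈g = HasDegree-resp {toPolynomial _} {toPolynomial _} (coefficient-cong k f≈g)

  Deg-≤ : ∀ {f m n} → Deg f m → Deg f n → m ≤ n
  Deg-≤ ((μ , ≡.refl , f≉0) , _) (_ , f≈0) = ℕ.≮⇒≥ λ n<m → f≉0 (f≈0 μ n<m)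

  Deg-unique : ∀ {f m n} → Deg f m → Deg f n → m ≡ n
  Deg-unique {f} d d′ = ℕ.≤-antisym (Deg-≤ {f} d d′) (Deg-≤ {f} d′ d)

  Deg⇒≉0 : ∀ {f m} → Deg f m → f A.≉ A.0#
  Deg⇒≉0 ((μ , _ , f≉0) , _) f≈0 = f≉0 (trans (coefficient-cong k f≈0 μ) (coefficient-0# k μ))

  homogeneousPart : ℕ → A.Carrier → Monomial k → Carrier
  homogeneousPart m f μ with ∣ μ ∣ₘ ℕ.≟ m
  ... | yes _ = coefficient k f μ
  ... | no  _ = 0#

  homogeneousPart-≡ : ∀ {m} f μ → ∣ μ ∣ₘ ≡ m → homogeneousPart m f μ ≈ coefficient k f μ
  homogeneousPart-≡ {m} f μ μ≡m with ∣ μ ∣ₘ ℕ.≟ m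
  ... | yes _   = refl
  ... | no  μ≢m = contradiction μ≡m μ≢m

  homogeneousPart-≢ : ∀ {m} f μ → ¬ ∣ μ ∣ₘ ≡ m → homogeneousPart m f μ ≈ 0#
  homogeneousPart-≢ {m} f μ μ≢m with ∣ μ ∣ₘ ℕ.≟ m
  ... | yes μ≡m = contradiction μ≡m μ≢m
  ... | no  _   = refl

  -- The component is assembled into an element of `A`, so that the absence of zero divisors applies
  -- to products of components.
  homogeneous : ℕ → A.Carrier → A.Carrier
  homogeneous m f = fromCoefficients k m (homogeneousPart m f)

  coefficient-homogeneous : ∀ m f μ → coefficient k (homogeneous m f) μ ≈ homogeneousPart m f μ
  coefficient-homogeneous m f = coefficient-fromCoefficients k m (homogeneousPart m f)
    λ μ m<μ → homogeneousPart-≢ f μ (ℕ.>⇒≢ m<μ)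

  -- Descent on the bound d: a nonzero coefficient in the component of degree d shows that the
  -- degree is d; if the component vanishes, d can be lowered by one.
  zero-or-Deg : ∀ d f → (∀ μ → d < ∣ μ ∣ₘ → coefficient k f μ ≈ 0#) → f A.≈ A.0# ⊎ ∃ (Deg f)
  zero-or-Deg d f f≈0 with zero-or-coefficient k (homogeneous d f)
  ... | inj₂ (μ , h≉0) with ∣ μ ∣ₘ ℕ.≟ d
  ...   | yes μ≡d = inj₂ (d , (μ , μ≡d , λ f≈0 → h≉0 (trans (coefficient-homogeneous d f μ)
                      (trans (homogeneousPart-≡ f μ μ≡d) f≈0))) , f≈0)
  ...   | no  μ≢d = contradiction (trans (coefficient-homogeneous d f μ) (homogeneousPart-≢ f μ μ≢d)) h≉0
  zero-or-Deg d f f≈0 | inj₁ h≈0 = go d f≈0 λ μ μ≡d →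
    trans (sym (homogeneousPart-≡ f μ μ≡d)) (trans (sym (coefficient-homogeneous d f μ))
      (trans (coefficient-cong k h≈0 μ) (coefficient-0# k μ)))
    where
    go : ∀ d → (∀ μ → d < ∣ μ ∣ₘ → coefficient k f μ ≈ 0#) →
         (∀ μ → ∣ μ ∣ₘ ≡ d → coefficient k f μ ≈ 0#) → f A.≈ A.0# ⊎ ∃ (Deg f)
    go zero    f≈0 f₀≈0 = inj₁ (coefficient-injective k λ μ → trans (all μ) (sym (coefficient-0# k μ)))
      where
      all : ∀ μ → coefficient k f μ ≈ 0#
      all μ with ∣ μ ∣ₘ in eq
      ... | zero  = f₀≈0 μ eq
      ... | suc _ = f≈0 μ (≡.subst (0 <_) (≡.sym eq) (s≤s z≤n))
    go (suc d) f≈0 f₁≈0 = zero-or-Deg d f λ μ d<μ → case μ (ℕ.m≤n⇒m<n∨m≡n d<μ)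
      where
      case : ∀ μ → suc d < ∣ μ ∣ₘ ⊎ suc d ≡ ∣ μ ∣ₘ → coefficient k f μ ≈ 0#
      case μ (inj₁ d<μ) = f≈0 μ d<μ
      case μ (inj₂ d≡μ) = f₁≈0 μ (≡.sym d≡μ)

  Deg-exists : ∀ {f} → f A.≉ A.0# → ∃ (Deg f)
  Deg-exists {f} f≉0 with degreeBound k f
  ... | d , f≈0 with zero-or-Deg d f f≈0
  ...   | inj₁ f≈0  = contradiction f≈0 f≉0
  ...   | inj₂ deg = deg

  homogeneous-≉0 : ∀ {f m} → Deg f m → homogeneous m f A.≉ A.0#
  homogeneous-≉0 {f} {m} ((μ , μ≡m , f≉0) , _) h≈0 = f≉0 (begin
    coefficient k f μ                 ≈⟨ homogeneousPart-≡ f μ μ≡m ⟨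
    homogeneousPart m f μ             ≈⟨ coefficient-homogeneous m f μ ⟨
    coefficient k (homogeneous m f) μ ≈⟨ coefficient-cong k h≈0 μ ⟩
    coefficient k A.0# μ              ≈⟨ coefficient-0# k μ ⟩
    0#                                ∎)

  -- The component of degree m + n of a product is the product of the components of
  -- degrees m and n, which does not vanish in a domain.
  Deg-* : ∀ {f g m n} → Deg f m → Deg g n → Deg (f A.* g) (m ℕ.+ n)
  Deg-* {f} {g} {m} {n} degᶠ@(_ , f≈0) degᵍ@(_ , g≈0) = top , λ μ m+n<μ →
    trans (coefficient-* k f g μ) (proj₂ (finite (mkPolynomial (coefficient k f) (m , f≈0) *ₚ
                                                mkPolynomial (coefficient k g) (n , g≈0))) μ m+n<μ)
    where
    fₘ gₙ : Monomial k → Carrier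
    fₘ = homogeneousPart m f
    gₙ = homogeneousPart n g

    coefficient-top : ∀ μ → coefficient k (homogeneous m f A.* homogeneous n g) μ ≈ convolution fₘ gₙ μ
    coefficient-top μ = trans (coefficient-* k (homogeneous m f) (homogeneous n g) μ)
      (convolution-cong _ _ _ _ μ λ ν ρ _ →
        *-cong (coefficient-homogeneous m f ν) (coefficient-homogeneous n g ρ))

    term : ∀ ν ρ → ∣ ν ∣ₘ ℕ.+ ∣ ρ ∣ₘ ≡ m ℕ.+ n → fₘ ν * gₙ ρ ≈ coefficient k f ν * coefficient k g ρ
    term ν ρ eq with ℕ.<-cmp ∣ ν ∣ₘ m
    ... | tri≈ _ ν≡m _ = *-cong (homogeneousPart-≡ f ν ν≡m) (homogeneousPart-≡ g ρ
            (ℕ.+-cancelˡ-≡ m _ _ (≡.trans (≡.cong (ℕ._+ ∣ ρ ∣ₘ) (≡.sym ν≡m)) eq)))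
    ... | tri< ν<m ν≢m _ = trans (*-congʳ (homogeneousPart-≢ f ν ν≢m)) (trans (zeroˡ _)
            (sym (trans (*-congˡ (g≈0 ρ (ℕ.≰⇒> λ ρ≤n → ℕ.<⇒≢ (ℕ.+-mono-<-≤ ν<m ρ≤n) eq))) (zeroʳ _))))
    ... | tri> _ ν≢m m<ν = trans (*-congʳ (homogeneousPart-≢ f ν ν≢m)) (trans (zeroˡ _)
            (sym (trans (*-congʳ (f≈0 ν m<ν)) (zeroˡ _))))

    term-0 : ∀ ν ρ → ¬ ∣ ν ∣ₘ ℕ.+ ∣ ρ ∣ₘ ≡ m ℕ.+ n → fₘ ν * gₙ ρ ≈ 0#
    term-0 ν ρ neq with ∣ ν ∣ₘ ℕ.≟ m | ∣ ρ ∣ₘ ℕ.≟ n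
    ... | yes ν≡m | yes ρ≡n = contradiction (≡.cong₂ ℕ._+_ ν≡m ρ≡n) neq
    ... | no  _   | _       = zeroˡ _
    ... | yes _   | no  _   = zeroʳ _

    top : ∃ λ μ → ∣ μ ∣ₘ ≡ m ℕ.+ n × coefficient k (f A.* g) μ ≉ 0#
    top with zero-or-coefficient k (homogeneous m f A.* homogeneous n g)
    ... | inj₁ fg≈0 = contradiction fg≈0 (*-≉0 (homogeneous-≉0 {f} degᶠ) (homogeneous-≉0 {g} degᵍ))
    ... | inj₂ (μ , fg≉0) with ∣ μ ∣ₘ ℕ.≟ m ℕ.+ n
    ...   | yes μ≡m+n = μ , μ≡m+n , λ fg≈0 → fg≉0 (begin
      coefficient k (homogeneous m f A.* homogeneous n g) μ ≈⟨ coefficient-top μ ⟩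
      convolution fₘ gₙ μ
        ≈⟨ convolution-cong _ _ _ _ μ (λ ν ρ eq → term ν ρ (≡.trans eq μ≡m+n)) ⟩
      convolution (coefficient k f) (coefficient k g) μ     ≈⟨ coefficient-* k f g μ ⟨
      coefficient k (f A.* g) μ                             ≈⟨ fg≈0 ⟩
      0#                                                    ∎)
    ...   | no  μ≢m+n = contradiction (trans (coefficient-top μ)
      (convolution-zero fₘ gₙ μ λ ν ρ eq → term-0 ν ρ λ eq′ → μ≢m+n (≡.trans (≡.sym eq) eq′))) fg≉0

  -- The factor `A.1#` brings the constant into the form whose coefficients
  -- `coefficient-constants-*` computes.
  Deg-0⇒constant : ∀ {f} → Deg f 0 → ∃ λ a → a ≉ 0# × f A.≈ constants k a A.* A.1#
  Deg-0⇒constant {f} ((μ , μ≡0 , f≉0) , f≈0) with ∣∣ₘ≡0 μ μ≡0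
  ... | ≡.refl = a , f≉0 , coefficient-injective k λ ν → sym (trans (coefficient-constants-* k a A.1# ν) (eq ν))
    where
    a : Carrier
    a = coefficient k f (Vec.replicate k 0)
    eq : ∀ ν → a * coefficient k A.1# ν ≈ coefficient k f ν
    eq ν with 0 ℕ.<? ∣ ν ∣ₘ
    ... | yes 0<ν = trans (*-congˡ (coefficient-1#-0 k ν 0<ν)) (trans (zeroʳ a) (sym (f≈0 ν 0<ν)))
    ... | no  0≮ν with ∣∣ₘ≡0 ν (ℕ.n≤0⇒n≡0 (ℕ.≮⇒≥ 0≮ν))
    ...   | ≡.refl = trans (*-congˡ (coefficient-1# k)) (*-identityʳ a)

  constants-inverse : ∀ {a} → a ≉ 0# → constants k a A.* A.1# ∣ A.1#
  constants-inverse {a} a≉0 with inverseˡ a a≉0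
  ... | b , ba≈1 = constants k b , coefficient-injective k λ μ → begin
    coefficient k (constants k b A.* (constants k a A.* A.1#)) μ ≈⟨ coefficient-constants-* k b _ μ ⟩
    b * coefficient k (constants k a A.* A.1#) μ ≈⟨ *-congˡ (coefficient-constants-* k a A.1# μ) ⟩
    b * (a * coefficient k A.1# μ)               ≈⟨ *-assoc b a _ ⟨
    b * a * coefficient k A.1# μ                 ≈⟨ *-congʳ ba≈1 ⟩
    1# * coefficient k A.1# μ                    ≈⟨ *-identityˡ _ ⟩
    coefficient k A.1# μ                         ∎

  Deg-0⇒∣1 : ∀ {f} → Deg f 0 → f ∣ A.1#
  Deg-0⇒∣1 {f} deg with Deg-0⇒constant {f} deg
  ... | a , a≉0 , f≈a = ∣-respˡ (A.sym f≈a) (constants-inverse a≉0)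

  Deg-1# : Deg A.1# 0
  Deg-1# = (_ , sum-replicate-0 k , λ eq → 1≉0 (trans (sym (coefficient-1# k)) eq)) , coefficient-1#-0 k
    where
    sum-replicate-0 : ∀ n → ∣ Vec.replicate n 0 ∣ₘ ≡ 0
    sum-replicate-0 zero    = ≡.refl
    sum-replicate-0 (suc n) = sum-replicate-0 n

  ∣1⇒Deg-0 : ∀ {f} → f ∣ A.1# → Deg f 0
  ∣1⇒Deg-0 {f} (w , wf≈1) = ≡.subst (Deg f) (ℕ.m+n≡0⇒n≡0 (proj₁ degʷ)
    (Deg-unique {w A.* f} (Deg-* {w} {f} (proj₂ degʷ) (proj₂ degᶠ))
                          (Deg-cong (A.sym wf≈1) Deg-1#))) (proj₂ degᶠ)
    where
    wf≉0 : w A.* f A.≉ A.0#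
    wf≉0 wf≈0 = Deg⇒≉0 {A.1#} Deg-1# (A.trans (A.sym wf≈1) wf≈0)
    degʷ : ∃ (Deg w)
    degʷ = Deg-exists (*-≉0⇒≉0ˡ wf≉0)
    degᶠ : ∃ (Deg f)
    degᶠ = Deg-exists (*-≉0⇒≉0ʳ wf≉0)

  ∼⇒∣ : ∀ {f g} → f ∼ g → fromPolynomial f ∣ fromPolynomial g
  ∼⇒∣ {f} {g} (a , _ , g≈af) = constants k a , coefficient-injective k λ μ → begin
    coefficient k (constants k a A.* fromPolynomial f) μ ≈⟨ coefficient-constants-* k a _ μ ⟩
    a * coefficient k (fromPolynomial f) μ  ≈⟨ *-congˡ (coefficient-fromPolynomial f μ) ⟩
    a * coeff f μ                           ≈⟨ g≈af μ ⟨
    coeff g μ                               ≈⟨ coefficient-fromPolynomial g μ ⟨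
    coefficient k (fromPolynomial g) μ      ∎

  ∼⇒∥ : ∀ {f g} → f ∼ g → fromPolynomial f ∥ fromPolynomial g
  ∼⇒∥ {f} {g} f∼g = ∼⇒∣ {f} {g} f∼g , ∼⇒∣ {g} {f} (Setoid.sym normalizedSetoid {f} {g} f∼g)

  -- Cancelling g from u v g = g shows that the cofactor u is a unit; units have degree 0 and are
  -- therefore nonzero constants.
  ∥⇒∼ : ∀ {f g} → g A.≉ A.0# → f ∥ g → toPolynomial f ∼ toPolynomial g
  ∥⇒∼ {f} {g} g≉0 ((u , uf≈g) , (v , vg≈f)) with Deg-0⇒constant {u} (∣1⇒Deg-0 u∣1)
    where
    u∣1 : u ∣ A.1#
    u∣1 = v , *-cancelˡ g≉0 (A.trans (A.*-comm g _) (A.trans (A.*-congʳ (A.*-comm v u))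
      (A.trans (A.*-assoc u v g) (A.trans (A.*-congˡ vg≈f) (A.trans uf≈g (A.sym (A.*-identityʳ g)))))))
  ... | a , a≉0 , u≈a = a , a≉0 , λ μ → begin
    coefficient k g μ                                  ≈⟨ coefficient-cong k uf≈g μ ⟨
    coefficient k (u A.* f) μ                          ≈⟨ coefficient-cong k (A.*-congʳ u≈a) μ ⟩
    coefficient k (constants k a A.* A.1# A.* f) μ     ≈⟨ coefficient-cong k (A.*-assoc _ A.1# f) μ ⟩
    coefficient k (constants k a A.* (A.1# A.* f)) μ   ≈⟨ coefficient-constants-* k a _ μ ⟩
    a * coefficient k (A.1# A.* f) μ                   ≈⟨ *-congˡ (coefficient-cong k (A.*-identityˡ f) μ) ⟩
    a * coefficient k f μ                              ∎

  fromPolynomial-toPolynomial : ∀ f → fromPolynomial (toPolynomial f) A.≈ f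
  fromPolynomial-toPolynomial f =
    coefficient-injective k (coefficient-fromPolynomial (toPolynomial f))

  *ₚ-homo : ∀ f g → toPolynomial (fromPolynomial f A.* fromPolynomial g) ≈ₚ f *ₚ g
  *ₚ-homo f g μ = trans (coefficient-* k (fromPolynomial f) (fromPolynomial g) μ)
    (convolution-cong _ _ _ _ μ λ ν ρ _ →
      *-cong (coefficient-fromPolynomial f ν) (coefficient-fromPolynomial g ρ))

  constant-1# : ∀ μ → coefficient k A.1# μ ≈ coeff (constant 1#) μ
  constant-1# μ with ≡-dec ℕ._≟_ μ (Vec.replicate k 0)
  ... | yes ≡.refl = coefficient-1# k
  ... | no  μ≢0    = coefficient-1#-0 k μ (ℕ.n≢0⇒n>0 λ μ≡0 → μ≢0 (∣∣ₘ≡0 μ μ≡0))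

  open Algebra.Definitions.RawSemiring rawSemiring using () renaming (_∣_ to _∣ₚ_)

  ∣1-fromPolynomial : ∀ {f} → f ∣ₚ constant 1# → fromPolynomial f ∣ A.1#
  ∣1-fromPolynomial {f} (w , wf≈1) = fromPolynomial w , coefficient-injective k λ μ →
    trans (*ₚ-homo w f μ) (trans (wf≈1 μ) (sym (constant-1# μ)))

  ∣1-fromPolynomial⁻¹ : ∀ {f} → fromPolynomial f ∣ A.1# → f ∣ₚ constant 1#
  ∣1-fromPolynomial⁻¹ {f} (w , wf≈1) = toPolynomial w , λ μ → begin
    convolution (coefficient k w) (coeff f) μ
      ≈⟨ convolution-cong _ _ _ _ μ (λ ν ρ _ → *-congˡ (coefficient-fromPolynomial f ρ)) ⟨
    convolution (coefficient k w) (coefficient k (fromPolynomial f)) μ ≈⟨ coefficient-* k w _ μ ⟨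
    coefficient k (w A.* fromPolynomial f) μ                           ≈⟨ coefficient-cong k wf≈1 μ ⟩
    coefficient k A.1# μ                                               ≈⟨ constant-1# μ ⟩
    coeff (constant 1#) μ                                              ∎

  Irreducible-fromPolynomial : ∀ {f} → Irreducible f → Irreducibleᴬ (fromPolynomial f)
  Irreducible-fromPolynomial {f} (mkIrred f∤1 split) = mkIrred (f∤1 ∘ ∣1-fromPolynomial⁻¹ {f}) splitᴬ
    where
    from∘to : ∀ {x} → toPolynomial x ∣ₚ constant 1# → x ∣ A.1#
    from∘to {x} x∣1 = ∣-respˡ (fromPolynomial-toPolynomial x) (∣1-fromPolynomial {toPolynomial x} x∣1)
    splitᴬ : ∀ {x y} → fromPolynomial f A.≈ x A.* y → x ∣ A.1# ⊎ y ∣ A.1#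
    splitᴬ {x} {y} f≈xy = Sum.map from∘to from∘to (split λ μ → begin
      coeff f μ                          ≈⟨ coefficient-fromPolynomial f μ ⟨
      coefficient k (fromPolynomial f) μ ≈⟨ coefficient-cong k f≈xy μ ⟩
      coefficient k (x A.* y) μ          ≈⟨ coefficient-* k x y μ ⟩
      coeff (toPolynomial x *ₚ toPolynomial y) μ ∎)

  Irreducible-toPolynomial : ∀ {f} → Irreducibleᴬ f → Irreducible (toPolynomial f)
  Irreducible-toPolynomial {f} (mkIrred f∤1 split) = mkIrred
    (λ f∣1 → f∤1 (∣-respˡ (fromPolynomial-toPolynomial f) (∣1-fromPolynomial {toPolynomial f} f∣1)))
    λ {x} {y} f≈xy → Sum.map ∣1-fromPolynomial⁻¹ ∣1-fromPolynomial⁻¹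
      (split {fromPolynomial x} {fromPolynomial y} (coefficient-injective k λ μ →
        trans (f≈xy μ) (sym (*ₚ-homo x y μ))))

-- Counting factorizations

∑ : (n : ℕ) → (ℕ → ℕ) → ℕ
∑ n f = sum {n} λ i → f (toℕ i)
  where open Algebra.Properties.Semiring.Sum ℕ.+-*-semiring using (sum)

-- Presents the sums of the count as finite types, so that inequalities between them become
-- injections.
Fin-∑ : ∀ n (a b : ℕ → ℕ) → Fin (∑ n λ i → a i ℕ.* b i) ↔ Σ (Fin n) λ i → Fin (a (toℕ i)) × Fin (b (toℕ i))
Fin-∑ zero    a b = mk↔ₛ′ (λ ()) (λ ()) (λ ()) (λ ())
Fin-∑ (suc n) a b =
  split ↔-∘ ((Fin.*↔× ⊎-↔ Fin-∑ n (a ∘ suc) (b ∘ suc)) ↔-∘ Fin.+↔⊎)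
  where
  T : ℕ → Set
  T i = Fin (a i) × Fin (b i)
  split : (T 0 ⊎ Σ (Fin n) (T ∘ suc ∘ toℕ)) ↔ Σ (Fin (suc n)) (T ∘ toℕ)
  split = mk↔ₛ′ (λ { (inj₁ x) → zero , x ; (inj₂ (i , x)) → suc i , x })
                (λ { (zero , x) → inj₁ x ; (suc i , x) → inj₂ (i , x) })
                (λ { (zero , x) → ≡.refl ; (suc i , x) → ≡.refl })
                (λ { (inj₁ x) → ≡.refl ; (inj₂ (i , x)) → ≡.refl })

injection⇒≤ : ∀ {a b m n} {X : Set a} {Y : Set b} → Fin m ↔ X → Fin n ↔ Y → (f : X → Y) → (∀ {x y} → f x ≡ f y → x ≡ y) → m ≤ n
injection⇒≤ m↔X n↔Y f injective = Fin.injective⇒≤ λ {i} {j} eq →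
  from-injective m↔X (injective (to-injective n↔Y eq))
  where
  open Inverse
  from-injective : ∀ {ℓ n} {X : Set ℓ} (n↔X : Fin n ↔ X) {i j} → to n↔X i ≡ to n↔X j → i ≡ j
  from-injective n↔X eq = ≡.trans (≡.sym (strictlyInverseʳ n↔X _))
    (≡.trans (≡.cong (from n↔X) eq) (strictlyInverseʳ n↔X _))
  to-injective : ∀ {ℓ n} {X : Set ℓ} (n↔X : Fin n ↔ X) {x y} → from n↔X x ≡ from n↔X y → x ≡ y
  to-injective n↔X eq = ≡.trans (≡.sym (strictlyInverseˡ n↔X _))
    (≡.trans (≡.cong (to n↔X) eq) (strictlyInverseˡ n↔X _))

module _ {c ℓ} (A : CommutativeRing c ℓ) where

  open CommutativeRing A
  open Divisibility A

  -- A system of representatives of the associate classes in P. With associates in place of `∼`, the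
  -- counting argument can be stated through divisibility and degree alone.
  record Enumeration {p} (P : Carrier → Set p) (n : ℕ) : Set (c ⊔ ℓ ⊔ p) where
    field
      elem           : Fin n → Carrier
      elem-∈         : ∀ i → P (elem i)
      index          : ∀ {x} → P x → Fin n
      elem-index     : ∀ {x} (x∈P : P x) → elem (index x∈P) ∥ x
      elem-injective : ∀ {i j} → elem i ∥ elem j → i ≡ j

  record DegreeFunction d : Set (c ⊔ ℓ ⊔ Level.suc d) where
    field
      Deg        : Carrier → ℕ → Set d
      Deg-unique : ∀ {x m n} → Deg x m → Deg x n → m ≡ n
      Deg-exists : ∀ {x} → x ≉ 0# → ∃ (Deg x)
      Deg⇒≉0     : ∀ {x m} → Deg x m → x ≉ 0#
      Deg-cong   : ∀ {x y m} → x ≈ y → Deg x m → Deg y m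
      Deg-*      : ∀ {x y m n} → Deg x m → Deg y n → Deg (x * y) (m ℕ.+ n)
      Deg-0⇒∣1   : ∀ {x} → Deg x 0 → x ∣ 1#
      ∣1⇒Deg-0   : ∀ {x} → x ∣ 1# → Deg x 0

module Counting {c ℓ d} (A : CommutativeRing c ℓ) (isGCDDomain : Divisibility.IsGCDDomain A)
  (degreeFunction : DegreeFunction A d) (N I : ℕ → ℕ)
  (enumN : ∀ m → Enumeration A (λ x → DegreeFunction.Deg degreeFunction x m) (N m))
  (enumI : ∀ m → Enumeration A (λ x → DegreeFunction.Deg degreeFunction x m ×
                                      Divisibility.Irreducible A x) (I m)) where

  open CommutativeRing A
  open Divisibility A hiding (mkGCD)
  open IsGCDDomain isGCDDomain
  open GCDDomain A isGCDDomain
  open DegreeFunction degreeFunction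
  private
    module N m = Enumeration (enumN m)
    module I m = Enumeration (enumI m)

  ∥-trans : ∀ {x y z} → x ∥ y → y ∥ z → x ∥ z
  ∥-trans (x∣y , y∣x) (y∣z , z∣y) = ∣-trans x∣y y∣z , ∣-trans z∣y y∣x

  ∥-sym : ∀ {x y} → x ∥ y → y ∥ x
  ∥-sym (x∣y , y∣x) = y∣x , x∣y

  ∥-*-cong : ∀ {w x y z} → w ∥ x → y ∥ z → w * y ∥ x * z
  ∥-*-cong (w∣x , x∣w) (y∣z , z∣y) = ∣-*-cong w∣x y∣z , ∣-*-cong x∣w z∣y

  ∥-≈ : ∀ {x y} → x ≈ y → x ∥ y
  ∥-≈ x≈y = ∣-respʳ x≈y ∣-refl , ∣-respʳ (sym x≈y) ∣-refl

  ∥-cancelˡ : ∀ {x y z} → x ≉ 0# → x * y ∥ x * z → y ∥ z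
  ∥-cancelˡ x≉0 (xy∣xz , xz∣xy) = ∣-cancelˡ x≉0 xy∣xz , ∣-cancelˡ x≉0 xz∣xy

  ∣⇒Deg-≤ : ∀ {x y m n} → x ∣ y → Deg x m → Deg y n → m ≤ n
  ∣⇒Deg-≤ {x} (w , wx≈y) degˣ degʸ with Deg-exists (*-≉0⇒≉0ˡ λ eq → Deg⇒≉0 degʸ (trans (sym wx≈y) eq))
  ... | a , degʷ = ≡.subst (_ ≤_) (Deg-unique (Deg-cong wx≈y (Deg-* degʷ degˣ)) degʸ) (ℕ.m≤n+m _ a)

  ∥⇒Deg-≡ : ∀ {x y m n} → x ∥ y → Deg x m → Deg y n → m ≡ n
  ∥⇒Deg-≡ (x∣y , y∣x) degˣ degʸ = ℕ.≤-antisym (∣⇒Deg-≤ x∣y degˣ degʸ) (∣⇒Deg-≤ y∣x degʸ degˣ)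

  -- Comparing positions in the finite enumeration decides associateness without any division
  -- algorithm.
  ∥? : ∀ {x y m} → Deg x m → Deg y m → Dec (x ∥ y)
  ∥? {x} {y} {m} degˣ degʸ = map′
    (λ eq → ∥-trans (∥-sym (N.elem-index m degˣ))
              (≡.subst (λ i → N.elem m i ∥ y) (≡.sym eq) (N.elem-index m degʸ)))
    (λ x∥y → N.elem-injective m (∥-trans (N.elem-index m degˣ) (∥-trans x∥y (∥-sym (N.elem-index m degʸ)))))
    (N.index m degˣ Fin.≟ N.index m degʸ)

  record Splitting (x : Carrier) (m : ℕ) : Set (c ⊔ ℓ ⊔ d) where
    constructor splitting
    field
      {left right} : Carrier
      {a b}        : ℕ
      deg-left     : Deg left a
      deg-right    : Deg right b
      a+b≡m        : a ℕ.+ b ≡ m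
      x∥           : x ∥ left * right

  -- A finite search: up to associates there are only finitely many pairs of factors of positive
  -- degree whose degrees add up to that of x.
  irreducible-or-splits : ∀ {x m} → 0 < m → Deg x m →
    Irreducible x ⊎ Σ (Splitting x m) λ s → 0 < Splitting.a s × 0 < Splitting.b s
  irreducible-or-splits {x} {suc m} _ degˣ
    -- The degree of x is `suc m` here, so `suc (toℕ i)` and `m ∸ toℕ i` run through all pairs of
    -- positive degrees with this sum.
    with Fin.any? (λ i → Fin.any? (λ j → Fin.any? (λ l → ∥? degˣ (deg i j l))))
    where
    deg : (i : Fin m) (j : Fin (N (suc (toℕ i)))) (l : Fin (N (m ∸ toℕ i))) →
          Deg (N.elem (suc (toℕ i)) j * N.elem (m ∸ toℕ i) l) (suc m)
    deg i j l = ≡.subst (Deg _) (≡.cong suc (ℕ.m+[n∸m]≡n (ℕ.<⇒≤ (Fin.toℕ<n i))))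
                  (Deg-* (N.elem-∈ (suc (toℕ i)) j) (N.elem-∈ (m ∸ toℕ i) l))
  ... | yes (i , j , l , x∥) = inj₂ (splitting (N.elem-∈ (suc (toℕ i)) j) (N.elem-∈ (m ∸ toℕ i) l)
          (≡.cong suc (ℕ.m+[n∸m]≡n (ℕ.<⇒≤ (Fin.toℕ<n i)))) x∥ , s≤s z≤n , ℕ.m<n⇒0<n∸m (Fin.toℕ<n i))
  ... | no ¬split = inj₁ (mkIrred (λ x∣1 → ℕ.0≢1+n (Deg-unique (∣1⇒Deg-0 x∣1) degˣ)) split)
    where
    split : ∀ {y z} → x ≈ y * z → y ∣ 1# ⊎ z ∣ 1#
    split {y} {z} x≈yz with Deg-exists (*-≉0⇒≉0ˡ yz≉0) | Deg-exists (*-≉0⇒≉0ʳ yz≉0)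
      where
      yz≉0 : y * z ≉ 0#
      yz≉0 yz≈0 = Deg⇒≉0 degˣ (trans x≈yz yz≈0)
    ... | zero  , degʸ | b     , degᶻ = inj₁ (Deg-0⇒∣1 degʸ)
    ... | suc a , degʸ | zero  , degᶻ = inj₂ (Deg-0⇒∣1 degᶻ)
    ... | suc a , degʸ | suc b , degᶻ = contradiction (i , find) ¬split
      where
      a+b≡m : a ℕ.+ suc b ≡ m
      a+b≡m = ℕ.suc-injective (Deg-unique (Deg-* degʸ degᶻ) (Deg-cong x≈yz degˣ))
      a<m : a < m
      a<m = ≡.subst (a <_) a+b≡m (ℕ.m<m+n a (s≤s z≤n))
      i : Fin m
      i = Fin.fromℕ< a<m
      a≡i : a ≡ toℕ i
      a≡i = ≡.sym (Fin.toℕ-fromℕ< a<m)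
      b≡m∸i : suc b ≡ m ∸ toℕ i
      b≡m∸i = ≡.trans (≡.sym (ℕ.m+n∸m≡n a (suc b))) (≡.cong₂ _∸_ a+b≡m a≡i)
      degʸ′ : Deg y (suc (toℕ i))
      degʸ′ = ≡.subst (Deg y) (≡.cong suc a≡i) degʸ
      degᶻ′ : Deg z (m ∸ toℕ i)
      degᶻ′ = ≡.subst (Deg z) b≡m∸i degᶻ
      find : ∃₂ λ j l → x ∥ N.elem (suc (toℕ i)) j * N.elem (m ∸ toℕ i) l
      find = N.index _ degʸ′ , N.index _ degᶻ′ , ∥-trans (∥-≈ x≈yz)
               (∥-sym (∥-*-cong (N.elem-index _ degʸ′) (N.elem-index _ degᶻ′)))

  -- The gcd g of p and x divides the irreducible p. If the cofactor is a unit, then p divides g and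
  -- so x, against the degrees; hence g is a unit, and p ∣ g y gives p ∣ y.
  irreducible-∣-* : ∀ {p x y m n} → Irreducible p → Deg p m → Deg x n → n < m → p ∣ x * y → p ∣ y
  irreducible-∣-* {p} {x} {y} (mkIrred p∤1 split) degᵖ degˣ n<m p∣xy = p∣y (gcd p x) (∣-*-gcd (gcd p x) p∣xy)
    where
    p∣y : (g : GCD p x) → p ∣ GCD.divisor g * y → p ∣ y
    p∣y (mkGCD g (w , wg≈p) g∣x _) p∣gy with split (sym wg≈p)
    ... | inj₂ g∣1       = ∣-trans p∣gy (∣-respʳ (*-identityˡ y) (∣-*-cong g∣1 ∣-refl))
    ... | inj₁ (v , vw≈1) = contradiction (∣⇒Deg-≤ (∣-trans p∣g g∣x) degᵖ degˣ) (ℕ.<⇒≱ n<m)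
      where
      p∣g : p ∣ g
      p∣g = v , trans (*-congˡ (sym wg≈p)) (trans (sym (*-assoc v w g))
                  (trans (*-congʳ vw≈1) (*-identityˡ g)))

  irreducible-∣⇒∥ : ∀ {p r} → Irreducible p → Irreducible r → p ∣ r → p ∥ r
  irreducible-∣⇒∥ (mkIrred p∤1 _) (mkIrred _ split) p∣r@(w , wp≈r) with split (sym wp≈r)
  ... | inj₂ p∣1        = contradiction p∣1 p∤1
  ... | inj₁ (v , vw≈1) = p∣r , v , trans (*-congˡ (sym wp≈r)) (trans (sym (*-assoc v w _))
                            (trans (*-congʳ vw≈1) (*-identityˡ _)))

  module _ {t m : ℕ} where

    LargeFactor : Set
    LargeFactor = Σ (Fin (suc t)) λ i → Fin (I (m ∸ toℕ i)) × Fin (N (toℕ i))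

    large-product : LargeFactor → Carrier
    large-product (i , j , l) = I.elem (m ∸ toℕ i) j * N.elem (toℕ i) l

    toℕ≤t : (i : Fin (suc t)) → toℕ i ≤ t
    toℕ≤t i = ℕ.≤-pred (Fin.toℕ<n i)

    -- The second cofactor has degree at most t < m - t, less than the degree of the first
    -- irreducible factor, which must therefore divide the second irreducible factor.
    large-product-∥⇒∥ : t ℕ.+ t < m → ∀ i j l i′ j′ l′ →
      large-product (i , j , l) ∥ large-product (i′ , j′ , l′) →
      I.elem (m ∸ toℕ i) j ∥ I.elem (m ∸ toℕ i′) j′
    large-product-∥⇒∥ t+t<m i j l i′ j′ l′ x∥y
      with I.elem-∈ (m ∸ toℕ i) j | I.elem-∈ (m ∸ toℕ i′) j′
    ... | degᵖ , irrᵖ | _ , irrᵖ′ = irreducible-∣⇒∥ irrᵖ irrᵖ′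
      (irreducible-∣-* irrᵖ degᵖ (N.elem-∈ (toℕ i′) l′)
        (ℕ.m+n≤o⇒m≤o∸n (suc (toℕ i′)) (ℕ.≤-trans (s≤s (ℕ.+-mono-≤ (toℕ≤t i′) (toℕ≤t i))) t+t<m))
        (∣-respʳ (*-comm _ _) (∣-trans (∣-*ʳ (N.elem (toℕ i) l) ∣-refl) (proj₁ x∥y))))

    -- The irreducible factor determines i through its degree, and then its own index; cancelling it
    -- leaves associated cofactors.
    large-product-injective : t ℕ.+ t < m → ∀ x y → large-product x ∥ large-product y → x ≡ y
    large-product-injective t+t<m (i , j , l) (i′ , j′ , l′) x∥y
      with Fin.toℕ-injective (ℕ.∸-cancelˡ-≡ (i≤m i) (i≤m i′)
             (∥⇒Deg-≡ (large-product-∥⇒∥ t+t<m i j l i′ j′ l′ x∥y)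
               (proj₁ (I.elem-∈ (m ∸ toℕ i) j)) (proj₁ (I.elem-∈ (m ∸ toℕ i′) j′))))
      where
      i≤m : ∀ i → toℕ i ≤ m
      i≤m i = ℕ.≤-trans (toℕ≤t i) (ℕ.≤-trans (ℕ.m≤m+n t t) (ℕ.<⇒≤ t+t<m))
    ... | ≡.refl with I.elem-injective (m ∸ toℕ i) (large-product-∥⇒∥ t+t<m i j l i j′ l′ x∥y)
    ...   | ≡.refl with N.elem-injective (toℕ i) (∥-cancelˡ (Deg⇒≉0 (proj₁ (I.elem-∈ (m ∸ toℕ i) j))) x∥y)
    ...     | ≡.refl = ≡.refl

    large-product-Deg : t ≤ m → ∀ x → Deg (large-product x) m
    large-product-Deg t≤m (i , j , l) = ≡.subst (Deg _) (ℕ.m∸n+n≡m (ℕ.≤-trans (toℕ≤t i) t≤m))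
      (Deg-* (proj₁ (I.elem-∈ (m ∸ toℕ i) j)) (N.elem-∈ (toℕ i) l))

    ∑I*N≤N : t ℕ.+ t < m → ∑ (suc t) (λ i → I (m ∸ i) ℕ.* N i) ≤ N m
    ∑I*N≤N t+t<m = injection⇒≤ (Fin-∑ (suc t) (λ i → I (m ∸ i)) N) (↔-id _)
      (λ x → N.index m (deg x)) λ {x} {y} eq → large-product-injective t+t<m x y
        (∥-trans (∥-sym (N.elem-index m (deg x)))
          (≡.subst (λ i → N.elem m i ∥ large-product y) (≡.sym eq) (N.elem-index m (deg y))))
      where
      deg : ∀ x → Deg (large-product x) m
      deg = large-product-Deg (ℕ.≤-trans (ℕ.m≤m+n t t) (ℕ.<⇒≤ t+t<m))

    private
      s r : ℕ
      s = suc t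
      -- There are `r ∸ 1` degrees d with s < d < m - s.
      r = m ∸ (s ℕ.+ s)

    -- The case that one of the degrees equals s is kept apart because it dominates the
    -- count.
    Balanced : Set
    Balanced = (Fin (N s) × Fin (N (m ∸ s))) ⊎
               Σ (Fin (r ∸ 1)) λ j → Fin (N (suc s ℕ.+ toℕ j)) × Fin (N (m ∸ (suc s ℕ.+ toℕ j)))

    balanced-product : Balanced → Carrier
    balanced-product (inj₁ (j , l))     = N.elem s j * N.elem (m ∸ s) l
    balanced-product (inj₂ (i , j , l)) =
      N.elem (suc s ℕ.+ toℕ i) j * N.elem (m ∸ (suc s ℕ.+ toℕ i)) l

    product : LargeFactor ⊎ Balanced → Carrier
    product = Sum.[ large-product , balanced-product ]

    -- If either degree equals s, that factor goes first, by commutativity if necessary, and the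
    -- pair lands in the first summand of `Balanced`; otherwise s < a < m - s.
    balanced : ∀ {x y z a b} → Deg x a → Deg y b → a ℕ.+ b ≡ m → s ≤ a → s ≤ b → z ∥ x * y →
               ∃ λ e → product e ∥ z
    balanced {x} {y} {z} {a} {b} degˣ degʸ a+b≡m s≤a s≤b z∥xy
      with ℕ.m≤n⇒m<n∨m≡n s≤a | ℕ.m≤n⇒m<n∨m≡n s≤b
    ... | inj₂ ≡.refl | _ = inj₂ (inj₁ (N.index s degˣ , N.index (m ∸ s) degʸ′)) ,
            ∥-trans (∥-*-cong (N.elem-index s degˣ) (N.elem-index (m ∸ s) degʸ′)) (∥-sym z∥xy)
      where
      degʸ′ : Deg y (m ∸ s)
      degʸ′ = ≡.subst (Deg y) (≡.trans (≡.sym (ℕ.m+n∸m≡n s b)) (≡.cong (_∸ s) a+b≡m)) degʸ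
    ... | inj₁ _ | inj₂ ≡.refl = inj₂ (inj₁ (N.index s degʸ , N.index (m ∸ s) degˣ′)) ,
            ∥-trans (∥-*-cong (N.elem-index s degʸ) (N.elem-index (m ∸ s) degˣ′))
                    (∥-sym (∥-trans z∥xy (∥-≈ (*-comm x y))))
      where
      degˣ′ : Deg x (m ∸ s)
      degˣ′ = ≡.subst (Deg x) (≡.trans (≡.sym (ℕ.m+n∸n≡m a s)) (≡.cong (_∸ s) a+b≡m)) degˣ
    ... | inj₁ s<a | inj₁ s<b = inj₂ (inj₂ (i , N.index _ degˣ′ , N.index _ degʸ′)) ,
            ∥-trans (∥-*-cong (N.elem-index _ degˣ′) (N.elem-index _ degʸ′)) (∥-sym z∥xy)
      where
      -- m - 2s - 1 = (a - s - 1) + (b - s)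
      j<r : a ∸ suc s < r ∸ 1
      j<r = ℕ.≤-trans (ℕ.m<m+n (a ∸ suc s) (ℕ.m<n⇒0<n∸m s<b)) (ℕ.≤-reflexive (begin
        (a ∸ suc s) ℕ.+ (b ∸ s)  ≡⟨ ℕ.+-∸-assoc (a ∸ suc s) (ℕ.<⇒≤ s<b) ⟨
        (a ∸ suc s) ℕ.+ b ∸ s    ≡⟨ ≡.cong (_∸ s) (ℕ.+-∸-comm b s<a) ⟨
        a ℕ.+ b ∸ suc s ∸ s      ≡⟨ ≡.cong (λ n → n ∸ suc s ∸ s) a+b≡m ⟩
        m ∸ suc s ∸ s            ≡⟨ ℕ.∸-+-assoc m (suc s) s ⟩
        m ∸ (suc s ℕ.+ s)        ≡⟨ ≡.cong (m ∸_) (ℕ.+-comm (s ℕ.+ s) 1) ⟨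
        m ∸ (s ℕ.+ s ℕ.+ 1)      ≡⟨ ℕ.∸-+-assoc m (s ℕ.+ s) 1 ⟨
        r ∸ 1                    ∎))
        where open ≡.≡-Reasoning
      i : Fin (r ∸ 1)
      i = Fin.fromℕ< j<r
      a≡ : a ≡ suc s ℕ.+ toℕ i
      a≡ = ≡.trans (≡.sym (ℕ.m+[n∸m]≡n s<a)) (≡.cong (suc s ℕ.+_) (≡.sym (Fin.toℕ-fromℕ< j<r)))
      degˣ′ : Deg x (suc s ℕ.+ toℕ i)
      degˣ′ = ≡.subst (Deg x) a≡ degˣ
      degʸ′ : Deg y (m ∸ (suc s ℕ.+ toℕ i))
      degʸ′ = ≡.subst (Deg y) (≡.trans (≡.sym (ℕ.m+n∸m≡n a b)) (≡.cong₂ _∸_ a+b≡m a≡)) degʸ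

    -- Split x and move the smaller factor to y, until x is irreducible or y would reach
    -- degree s; in the latter case the remaining factor of x also has degree at least s.
    decompose : ∀ fuel {x y z n i} → t ∸ i < fuel → s ℕ.+ s ℕ.+ t ≤ m → i ≤ t → n ℕ.+ i ≡ m →
                Deg x n → Deg y i → z ∥ x * y → ∃ λ e → product e ∥ z
    decompose-split : ∀ fuel {x x₁ x₂ y z n i a b} → t ∸ i ≤ fuel → s ℕ.+ s ℕ.+ t ≤ m → i ≤ t → n ℕ.+ i ≡ m →
                Deg x₁ a → Deg x₂ b → a ℕ.+ b ≡ n → x ∥ x₁ * x₂ → 0 < b → b ≤ a →
                Deg y i → z ∥ x * y → ∃ λ e → product e ∥ z

    decompose (suc fuel) {x} {y} {z} {n} {i} (s≤s lt) large i≤t n+i≡m degˣ degʸ z∥xy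
      with irreducible-or-splits {x} {n} 0<n degˣ
      where
      0<n : 0 < n
      0<n = ℕ.≰⇒> λ n≤0 → ℕ.<⇒≱ (ℕ.m<n+m t (s≤s z≤n))
        (ℕ.≤-trans large (ℕ.≤-trans (ℕ.≤-reflexive (≡.sym n+i≡m)) (ℕ.+-mono-≤ n≤0 i≤t)))
    ... | inj₁ irr = inj₁ (i′ , I.index _ x∈ , N.index _ degʸ′) ,
            ∥-trans (∥-*-cong (I.elem-index _ x∈) (N.elem-index _ degʸ′)) (∥-sym z∥xy)
      where
      i′ : Fin (suc t)
      i′ = Fin.fromℕ< (s≤s i≤t)
      i≡i′ : i ≡ toℕ i′
      i≡i′ = ≡.sym (Fin.toℕ-fromℕ< (s≤s i≤t))
      x∈ : Deg x (m ∸ toℕ i′) × Irreducible x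
      x∈ = ≡.subst (Deg x) (≡.trans (≡.sym (ℕ.m+n∸n≡m n i)) (≡.cong₂ _∸_ n+i≡m i≡i′)) degˣ , irr
      degʸ′ : Deg y (toℕ i′)
      degʸ′ = ≡.subst (Deg y) i≡i′ degʸ
    ... | inj₂ (splitting {x₁} {x₂} {a} {b} deg₁ deg₂ a+b≡n x∥ , 0<a , 0<b) with ℕ.≤-total b a
    ...   | inj₁ b≤a = decompose-split fuel lt large i≤t n+i≡m deg₁ deg₂ a+b≡n x∥ 0<b b≤a degʸ z∥xy
    ...   | inj₂ a≤b = decompose-split fuel lt large i≤t n+i≡m deg₂ deg₁ (≡.trans (ℕ.+-comm b a) a+b≡n)
                         (∥-trans x∥ (∥-≈ (*-comm x₁ x₂))) 0<a a≤b degʸ z∥xy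

    decompose-split fuel {x} {x₁} {x₂} {y} {z} {n} {i} {a} {b}
        lt large i≤t n+i≡m deg₁ deg₂ a+b≡n x∥ 0<b b≤a degʸ z∥xy with b ℕ.+ i ℕ.≤? t
    ... | yes b+i≤t = decompose fuel
            -- The degree of the second factor grows by b > 0 without passing t, so `t ∸ i` strictly
            -- decreases and the fuel suffices.
            (ℕ.<-≤-trans (ℕ.∸-monoʳ-< {t} (ℕ.m<n+m i 0<b) b+i≤t) lt) large b+i≤t a+[b+i]≡m deg₁ (Deg-* deg₂ degʸ) z∥
      where
      a+[b+i]≡m : a ℕ.+ (b ℕ.+ i) ≡ m
      a+[b+i]≡m = ≡.trans (≡.sym (ℕ.+-assoc a b i)) (≡.trans (≡.cong (ℕ._+ i) a+b≡n) n+i≡m)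
      z∥ : z ∥ x₁ * (x₂ * y)
      z∥ = ∥-trans z∥xy (∥-trans (∥-*-cong x∥ (∥-≈ refl)) (∥-≈ (*-assoc x₁ x₂ y)))
    ... | no  b+i≰t = balanced deg₁ (Deg-* deg₂ degʸ) a+[b+i]≡m s≤a (ℕ.≰⇒> b+i≰t) z∥
      where
      a+[b+i]≡m : a ℕ.+ (b ℕ.+ i) ≡ m
      a+[b+i]≡m = ≡.trans (≡.sym (ℕ.+-assoc a b i)) (≡.trans (≡.cong (ℕ._+ i) a+b≡n) n+i≡m)
      z∥ : z ∥ x₁ * (x₂ * y)
      z∥ = ∥-trans z∥xy (∥-trans (∥-*-cong x∥ (∥-≈ refl)) (∥-≈ (*-assoc x₁ x₂ y)))
      -- If a < s, then also b < s, and m = a + b + i < 2s + t, contrary to `large`.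
      s≤a : s ≤ a
      s≤a = ℕ.≮⇒≥ λ a<s → ℕ.<⇒≱ (ℕ.+-mono-<-≤ (ℕ.+-mono-<-≤ a<s (ℕ.≤-trans b≤a (ℕ.<⇒≤ a<s))) i≤t)
        (ℕ.≤-trans large (ℕ.≤-reflexive (≡.trans (≡.sym a+[b+i]≡m) (≡.sym (ℕ.+-assoc a b i)))))

    -- A polynomial may have several decompositions, but a decomposition determines its product; so
    -- any choice of one for each class is injective.
    N≤∑I*N+ : s ℕ.+ s ℕ.+ t ≤ m → N m ≤ ∑ (suc t) (λ i → I (m ∸ i) ℕ.* N i) ℕ.+
      (N s ℕ.* N (m ∸ s) ℕ.+ ∑ (r ∸ 1) (λ j → N (suc s ℕ.+ j) ℕ.* N (m ∸ (suc s ℕ.+ j))))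
    N≤∑I*N+ large = injection⇒≤ (↔-id _)
      ((Fin-∑ (suc t) (λ i → I (m ∸ i)) N ⊎-↔
        ((Fin.*↔× ⊎-↔ Fin-∑ (r ∸ 1) (λ j → N (suc s ℕ.+ j)) (λ j → N (m ∸ (suc s ℕ.+ j)))) ↔-∘ Fin.+↔⊎)) ↔-∘ Fin.+↔⊎)
      (λ i → proj₁ (code i))
      λ {i} {j} eq → N.elem-injective m (∥-trans (∥-sym (proj₂ (code i)))
        (≡.subst (λ e → product e ∥ N.elem m j) (≡.sym eq) (proj₂ (code j))))
      where
      code : ∀ i → ∃ λ e → product e ∥ N.elem m i
      -- The start is the trivial product with y = 1, of degree i = 0.
      code i = decompose (suc t) (s≤s (ℕ.m∸n≤m t 0)) large z≤n (ℕ.+-identityʳ m) (N.elem-∈ m i)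
        (∣1⇒Deg-0 ∣-refl) (∥-≈ (sym (*-identityʳ _)))

-- Normalized polynomials

-- The number of functions to a q-element set from the monomials of degree at most d in n variables.
-- The recursion separates the monomials divisible by the first variable from the others; on
-- exponents of q it is Pascal's rule.
functionCount : ℕ → ℕ → ℕ → ℕ
functionCount q zero    d       = q
functionCount q (suc n) zero    = functionCount q n zero
functionCount q (suc n) (suc d) = functionCount q (suc n) d ℕ.* functionCount q n (suc d)

functionCount≡ : ∀ q n d → functionCount q n d ≡ q ^ ((d ℕ.+ n) C n)
functionCount≡ q zero    d       = ≡.sym (ℕ.^-identityʳ q)
functionCount≡ q (suc n) zero    = ≡.trans (functionCount≡ q n zero)
  (≡.cong (q ^_) (≡.trans (nCn≡1 n) (≡.sym (nCn≡1 (suc n)))))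
functionCount≡ q (suc n) (suc d) = begin
  functionCount q (suc n) d ℕ.* functionCount q n (suc d)
    ≡⟨ ≡.cong₂ ℕ._*_ (functionCount≡ q (suc n) d) (functionCount≡ q n (suc d)) ⟩
  q ^ ((d ℕ.+ suc n) C suc n) ℕ.* q ^ ((suc d ℕ.+ n) C n)
    ≡⟨ ℕ.^-distribˡ-+-* q ((d ℕ.+ suc n) C suc n) ((suc d ℕ.+ n) C n) ⟨
  q ^ ((d ℕ.+ suc n) C suc n ℕ.+ (suc d ℕ.+ n) C n)
    ≡⟨ ≡.cong (q ^_) (ℕ.+-comm ((d ℕ.+ suc n) C suc n) _) ⟩
  q ^ ((suc d ℕ.+ n) C n ℕ.+ (d ℕ.+ suc n) C suc n)
    ≡⟨ ≡.cong (λ x → q ^ (x C n ℕ.+ (d ℕ.+ suc n) C suc n)) (ℕ.+-suc d n) ⟨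
  q ^ ((d ℕ.+ suc n) C n ℕ.+ (d ℕ.+ suc n) C suc n)
    ≡⟨ ≡.cong (q ^_) (nCk+nC[k+1]≡[n+1]C[k+1] (d ℕ.+ suc n) n) ⟩
  q ^ ((suc d ℕ.+ suc n) C suc n) ∎
  where open ≡.≡-Reasoning

lower : ∀ {a} {X : Set a} {n} → (Monomial (suc n) → X) → Monomial (suc n) → X
lower f (e ∷ μ) = f (suc e ∷ μ)

encode : ∀ {q} n d → (Monomial n → Fin q) → Fin (functionCount q n d)
encode zero    d       f = f []
encode (suc n) zero    f = encode n zero (f ∘ (0 ∷_))
encode (suc n) (suc d) f = combine (encode (suc n) d (lower f)) (encode n (suc d) (f ∘ (0 ∷_)))

encode-injective : ∀ {q} n d (f g : Monomial n → Fin q) → encode n d f ≡ encode n d g →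
                   ∀ μ → ∣ μ ∣ₘ ≤ d → f μ ≡ g μ
encode-injective zero    d       f g eq []          _   = eq
encode-injective (suc n) zero    f g eq (zero ∷ μ)  μ≤0 =
  encode-injective n zero (f ∘ (0 ∷_)) (g ∘ (0 ∷_)) eq μ μ≤0
encode-injective (suc n) (suc d) f g eq μ μ≤d
  with Fin.combine-injective (encode (suc n) d (lower f)) (encode n (suc d) (f ∘ (0 ∷_)))
                             (encode (suc n) d (lower g)) (encode n (suc d) (g ∘ (0 ∷_))) eq
encode-injective (suc n) (suc d) f g eq (zero ∷ μ)  μ≤d       | _ , eq₀ =
  encode-injective n (suc d) (f ∘ (0 ∷_)) (g ∘ (0 ∷_)) eq₀ μ μ≤d
encode-injective (suc n) (suc d) f g eq (suc e ∷ μ) (s≤s μ≤d) | eq₁ , _ =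
  encode-injective (suc n) d (lower f) (lower g) eq₁ (e ∷ μ) μ≤d

module NormalizedPolynomials {c ℓ q} (F : FiniteField c ℓ q) (k : ℕ) where

  open FiniteField F using (sym; trans; 1#; 1≉0; *-identityˡ; cardinality)
  open TotalDegree F k
  open Polynomials F k hiding (NormalizedOfDegree; IrreducibleOfDegree)
  open Divisibility A renaming (Irreducible to Irreducibleᴬ)

  ≈ₚ⇒∼ : ∀ {f g} → f ≈ₚ g → f ∼ g
  ≈ₚ⇒∼ f≈g = 1# , 1≉0 , λ μ → trans (sym (f≈g μ)) (sym (*-identityˡ _))

  degreeFunction : DegreeFunction A ℓ
  degreeFunction = record
    { Deg        = Deg
    ; Deg-unique = λ {f} → Deg-unique {f}
    ; Deg-exists = Deg-exists
    ; Deg⇒≉0     = λ {f} → Deg⇒≉0 {f}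
    ; Deg-cong   = Deg-cong
    ; Deg-*      = λ {f} {g} → Deg-* {f} {g}
    ; Deg-0⇒∣1   = λ {f} → Deg-0⇒∣1 {f}
    ; ∣1⇒Deg-0   = ∣1⇒Deg-0
    }

  -- Turns a count of classes under `∼` into representatives up to associates, by `∼⇒∥` and `∥⇒∼`;
  -- the latter is where the elements have to be nonzero.
  enumeration : ∀ {p p′ n} {P : Polynomial → Set p} {Q : A.Carrier → Set p′} →
    On.setoid {B = Σ Polynomial P} normalizedSetoid proj₁ HasCardinality n →
    (∀ {f} → P f → Q (fromPolynomial f)) → (∀ {x} → Q x → P (toPolynomial x)) →
    (∀ {x} → Q x → x A.≉ A.0#) → Enumeration A Q n
  enumeration {n = n} {P} {Q} card P⇒Q Q⇒P Q⇒≉0 = record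
    { elem           = elem
    ; elem-∈         = λ i → P⇒Q (proj₂ (from i))
    ; index          = λ {x} x∈Q → to (toPolynomial x , Q⇒P x∈Q)
    ; elem-index     = λ {x} x∈Q →
        let eq = ∼⇒∥ {proj₁ (from (to (toPolynomial x , Q⇒P x∈Q)))} {toPolynomial x}
                   (strictlyInverseʳ (toPolynomial x , Q⇒P x∈Q))
        in ∣-respʳ (fromPolynomial-toPolynomial x) (proj₁ eq) , ∣-respˡ (fromPolynomial-toPolynomial x) (proj₂ eq)
    ; elem-injective = λ {i} {j} i∥j → ≡.trans (≡.sym (strictlyInverseˡ i)) (≡.trans
        (to-cong (∼-trans {poly i} {toPolynomial (elem i)} {poly j} (≈ₚ⇒∼ {poly i} {toPolynomial (elem i)}
            (λ μ → sym (coefficient-fromPolynomial (poly i) μ)))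
          (∼-trans {toPolynomial (elem i)} {toPolynomial (elem j)} {poly j}
            (∥⇒∼ {elem i} {elem j} (Q⇒≉0 (P⇒Q (proj₂ (from j)))) i∥j)
            (≈ₚ⇒∼ {toPolynomial (elem j)} {poly j} (coefficient-fromPolynomial (poly j))))))
        (strictlyInverseˡ j))
    }
    where
    open Inverse card
    open Setoid normalizedSetoid using () renaming (trans to ∼-trans)
    poly : Fin n → Polynomial
    poly i = proj₁ (from i)
    elem : Fin n → A.Carrier
    elem i = fromPolynomial (poly i)

  Deg-fromPolynomial : ∀ {f m} → HasDegree f m → Deg (fromPolynomial f) m
  Deg-fromPolynomial {f} = HasDegree-resp {f} {toPolynomial (fromPolynomial f)}
    λ μ → sym (coefficient-fromPolynomial f μ)

  normalized-enumeration : ∀ {m n} → NormalizedOfDegree F k m HasCardinality n →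
    Enumeration A (λ x → Deg x m) n
  normalized-enumeration card = enumeration card
    (λ {f} → Deg-fromPolynomial {f}) id (λ {x} → Deg⇒≉0 {x})

  irreducible-enumeration : ∀ {m n} → IrreducibleOfDegree F k m HasCardinality n →
    Enumeration A (λ x → Deg x m × Irreducibleᴬ x) n
  irreducible-enumeration card = enumeration card
    (λ {f} (deg , irr) → Deg-fromPolynomial {f} deg , Irreducible-fromPolynomial {f} irr)
    (λ {x} (deg , irr) → deg , Irreducible-toPolynomial irr)
    (λ {x} (deg , _) → Deg⇒≉0 {x} deg)

  -- Each class is sent to the coefficients of its chosen representative at monomials of degree at
  -- most m. The other coefficients vanish, so this is injective.
  normalized-≤ : ∀ {m n} → NormalizedOfDegree F k m HasCardinality n → n ≤ q ^ ((m ℕ.+ k) C k)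
  normalized-≤ {m} {n} card = ≡.subst (n ≤_) (functionCount≡ q k m) (Fin.injective⇒≤ {f = code} injective)
    where
    open Inverse card
    module F = Inverse cardinality
    coeffᶠ : Fin n → Monomial k → Fin q
    coeffᶠ i μ = F.to (coeff (proj₁ (from i)) μ)
    code : Fin n → Fin (functionCount q k m)
    code i = encode k m (coeffᶠ i)
    injective : ∀ {i j} → code i ≡ code j → i ≡ j
    injective {i} {j} eq = ≡.trans (≡.sym (strictlyInverseˡ i))
      (≡.trans (to-cong (≈ₚ⇒∼ {proj₁ (from i)} {proj₁ (from j)} same)) (strictlyInverseˡ j))
      where
      same : proj₁ (from i) ≈ₚ proj₁ (from j)
      same μ with m ℕ.<? ∣ μ ∣ₘ
      ... | yes m<μ = trans (proj₂ (proj₂ (from i)) μ m<μ) (sym (proj₂ (proj₂ (from j)) μ m<μ))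
      ... | no  m≮μ = trans (sym (F.strictlyInverseʳ _)) (trans
        (F.from-cong (encode-injective k m (coeffᶠ i) (coeffᶠ j) eq μ (ℕ.≮⇒≥ m≮μ))) (F.strictlyInverseʳ _))

  -- Elements of degree 0 are units, hence pairwise associated, and `A.1#` is one of them.
  normalized-0 : ∀ {n} → NormalizedOfDegree F k 0 HasCardinality n → n ≡ 1
  normalized-0 {n} card = ℕ.≤-antisym (Fin.injective⇒≤ {n} {1} {f = λ _ → zero} λ {i} {j} _ → elem-injective
      (∣-trans (unit i) (1∣ _) , ∣-trans (unit j) (1∣ _)))
    (Fin.injective⇒≤ {1} {n} {f = λ _ → index Deg-1#} λ { {zero} {zero} _ → ≡.refl })
    where
    open Enumeration (normalized-enumeration card)
    unit : ∀ i → elem i ∣ A.1#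
    unit i = Deg-0⇒∣1 {elem i} (elem-∈ i)

-- Asymptotics

open import Data.Integer.Base using (ℤ; +_; -_; _-_; ∣_∣; 1ℤ; 0ℤ)
  renaming (_*_ to _*ℤ_; _+_ to _+ℤ_)
import Data.Integer.Properties as ℤ

∑-mono-≤ : ∀ n {f g} → (∀ i → i < n → f i ≤ g i) → ∑ n f ≤ ∑ n g
∑-mono-≤ zero    f≤g = z≤n
∑-mono-≤ (suc n) f≤g = ℕ.+-mono-≤ (f≤g 0 (s≤s z≤n)) (∑-mono-≤ n λ i i<n → f≤g (suc i) (s≤s i<n))

∑-const : ∀ n a → ∑ n (λ _ → a) ≡ n ℕ.* a
∑-const zero    a = ≡.refl
∑-const (suc n) a = ≡.cong (a ℕ.+_) (∑-const n a)

-- The function b of the bounds: the number of monomials of degree at most d in k variables.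
monomials : ℕ → ℕ → ℕ
monomials k d = (d ℕ.+ k) C k

monomials-suc : ∀ k d → monomials (suc k) (suc d) ≡ monomials k (suc d) ℕ.+ monomials (suc k) d
monomials-suc k d = ≡.sym (≡.trans
  (≡.cong (λ n → n C k ℕ.+ (d ℕ.+ suc k) C suc k) (≡.sym (ℕ.+-suc d k)))
  (nCk+nC[k+1]≡[n+1]C[k+1] (d ℕ.+ suc k) k))

monomials-mono : ∀ k d → monomials k d ≤ monomials k (suc d)
monomials-mono zero    d = ℕ.≤-refl
monomials-mono (suc k) d = ≡.subst (monomials (suc k) d ≤_) (≡.sym (monomials-suc k d)) (ℕ.m≤n+m _ _)

monomials-mono-≤ : ∀ k {c d} → c ≤ d → monomials k c ≤ monomials k d
monomials-mono-≤ k {c} c≤d = ≡.subst (λ d → monomials k c ≤ monomials k d) (ℕ.m∸n+n≡m c≤d) (go (_ ∸ c))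
  where
  go : ∀ j → monomials k c ≤ monomials k (j ℕ.+ c)
  go zero    = ℕ.≤-refl
  go (suc j) = ℕ.≤-trans (go j) (monomials-mono k (j ℕ.+ c))

0<monomials : ∀ k d → 0 < monomials k d
0<monomials k d = ℕ.≤-trans (ℕ.≤-reflexive (≡.sym (nCn≡1 k))) (monomials-mono-≤ k (z≤n {d}))

d<monomials : ∀ k d → d < monomials (suc k) d
d<monomials k zero    = 0<monomials (suc k) 0
d<monomials k (suc d) = ≡.subst (suc d <_) (≡.sym (monomials-suc k d))
  (ℕ.+-mono-≤ (0<monomials k (suc d)) (d<monomials k d))

-- Shifting j from the smaller argument to the larger one does not decrease the sum: by Pascal's
-- rule the increments are values of `monomials` with one variable fewer, which are monotone.
monomials-convex : ∀ k a {c} j → a ≤ c →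
  monomials k (a ℕ.+ j) ℕ.+ monomials k c ≤ monomials k a ℕ.+ monomials k (c ℕ.+ j)
monomials-convex zero    a j a≤c = ℕ.≤-refl
monomials-convex (suc k) a {c} zero a≤c rewrite ℕ.+-identityʳ a | ℕ.+-identityʳ c = ℕ.≤-refl
monomials-convex (suc k) a {c} (suc j) a≤c rewrite ℕ.+-suc a j | ℕ.+-suc c j = begin
  M (suc (a ℕ.+ j)) ℕ.+ M c                         ≡⟨ ≡.cong (ℕ._+ M c) (monomials-suc k (a ℕ.+ j)) ⟩
  M′ (suc (a ℕ.+ j)) ℕ.+ M (a ℕ.+ j) ℕ.+ M c         ≡⟨ ℕ.+-assoc (M′ (suc (a ℕ.+ j))) _ _ ⟩
  M′ (suc (a ℕ.+ j)) ℕ.+ (M (a ℕ.+ j) ℕ.+ M c)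
    ≤⟨ ℕ.+-mono-≤ (monomials-mono-≤ k (s≤s (ℕ.+-monoˡ-≤ j a≤c))) (monomials-convex (suc k) a j a≤c) ⟩
  M′ (suc (c ℕ.+ j)) ℕ.+ (M a ℕ.+ M (c ℕ.+ j))       ≡⟨ x∙yz≈y∙xz (M′ (suc (c ℕ.+ j))) (M a) (M (c ℕ.+ j)) ⟩
  M a ℕ.+ (M′ (suc (c ℕ.+ j)) ℕ.+ M (c ℕ.+ j))       ≡⟨ ≡.cong (M a ℕ.+_) (monomials-suc k (c ℕ.+ j)) ⟨
  M a ℕ.+ M (suc (c ℕ.+ j))                         ∎
  where
  open ℕ.≤-Reasoning
  open Algebra.Properties.CommutativeSemigroup ℕ.+-commutativeSemigroup using (x∙yz≈y∙xz)
  M M′ : ℕ → ℕ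
  M  = monomials (suc k)
  M′ = monomials k

-- By Pascal's rule the increment is `monomials (k ∸ 1) (suc d)`, which exceeds d as soon as one
-- variable is left. In `balanced-≤` the resulting factor q^d pays for the number of terms.
monomials-gap : ∀ {k} → 2 ≤ k → ∀ d → d ℕ.+ monomials k d ≤ monomials k (suc d)
monomials-gap {suc zero}    (s≤s ())
monomials-gap {suc (suc k)} _ d =
  ≡.subst (d ℕ.+ monomials (suc (suc k)) d ≤_) (≡.sym (monomials-suc (suc k) d))
    (ℕ.+-monoˡ-≤ _ (ℕ.≤-trans (ℕ.n≤1+n d) (ℕ.<⇒≤ (d<monomials k (suc d)))))

n≤q^n : ∀ {q} → 2 ≤ q → ∀ n → n ≤ q ^ n
n≤q^n         2≤q zero    = z≤n
n≤q^n {suc q} 2≤q (suc n) = begin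
  suc n                     ≤⟨ ℕ.+-mono-≤ (ℕ.m^n>0 (suc q) n) (n≤q^n 2≤q n) ⟩
  suc q ^ n ℕ.+ suc q ^ n   ≡⟨ ≡.cong (suc q ^ n ℕ.+_) (ℕ.+-identityʳ _) ⟨
  2 ℕ.* suc q ^ n           ≤⟨ ℕ.*-monoˡ-≤ (suc q ^ n) 2≤q ⟩
  suc q ℕ.* suc q ^ n       ∎
  where open ℕ.≤-Reasoning

module Bounds (q k : ℕ) (2≤q : 2 ≤ q) (2≤k : 2 ≤ k) (N : ℕ → ℕ)
              (N≤ : ∀ d → N d ≤ q ^ monomials k d) where

  private
    instance
      q≢0 : NonZero q
      q≢0 = ℕ.>-nonZero (ℕ.<-trans (s≤s z≤n) 2≤q)

    M : ℕ → ℕ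
    M = monomials k

  -- Among pairs of degrees at least a with a fixed sum, convexity makes the extreme pair a, a + l +
  -- j dominate.
  N*N≤ : ∀ a j l → N (a ℕ.+ j) ℕ.* N (a ℕ.+ l) ≤ q ^ M a ℕ.* q ^ M (a ℕ.+ l ℕ.+ j)
  N*N≤ a j l = begin
    N (a ℕ.+ j) ℕ.* N (a ℕ.+ l)            ≤⟨ ℕ.*-mono-≤ (N≤ (a ℕ.+ j)) (N≤ (a ℕ.+ l)) ⟩
    q ^ M (a ℕ.+ j) ℕ.* q ^ M (a ℕ.+ l)    ≡⟨ ℕ.^-distribˡ-+-* q (M (a ℕ.+ j)) _ ⟨
    q ^ (M (a ℕ.+ j) ℕ.+ M (a ℕ.+ l))      ≤⟨ ℕ.^-monoʳ-≤ q (monomials-convex k a j (ℕ.m≤m+n a l)) ⟩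
    q ^ (M a ℕ.+ M (a ℕ.+ l ℕ.+ j))        ≡⟨ ℕ.^-distribˡ-+-* q (M a) _ ⟩
    q ^ M a ℕ.* q ^ M (a ℕ.+ l ℕ.+ j)      ∎
    where open ℕ.≤-Reasoning

  -- The pair s, m - s already has the full order of magnitude. Every other term is at most q^b(s +
  -- 1) q^b(m - s - 1); there are at most m - s - 1 ≤ q^(m - s - 1) of them, and `monomials-gap`
  -- turns this factor into the step from b(m - s - 1) to b(m - s).
  balanced-≤ : ∀ s m → suc s ≤ m →
    N s ℕ.* N (m ∸ s) ℕ.+ ∑ (m ∸ (s ℕ.+ s) ∸ 1) (λ j → N (suc s ℕ.+ j) ℕ.* N (m ∸ (suc s ℕ.+ j))) ≤
    (q ^ M s ℕ.+ q ^ M (suc s)) ℕ.* q ^ M (m ∸ s)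
  balanced-≤ s m s<m = begin
    N s ℕ.* N (m ∸ s) ℕ.+ ∑ r (λ j → N (suc s ℕ.+ j) ℕ.* N (m ∸ (suc s ℕ.+ j)))
      ≤⟨ ℕ.+-mono-≤ (ℕ.*-mono-≤ (N≤ s) (N≤ (m ∸ s))) middle ⟩
    q ^ M s ℕ.* q ^ M (m ∸ s) ℕ.+ q ^ M (suc s) ℕ.* q ^ M (m ∸ s)
      ≡⟨ ℕ.*-distribʳ-+ (q ^ M (m ∸ s)) (q ^ M s) _ ⟨
    (q ^ M s ℕ.+ q ^ M (suc s)) ℕ.* q ^ M (m ∸ s) ∎
    where
    open ℕ.≤-Reasoning
    r : ℕ
    r = m ∸ (s ℕ.+ s) ∸ 1
    r≡ : r ≡ m ∸ suc s ∸ s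
    r≡ = ≡.trans (ℕ.∸-+-assoc m (s ℕ.+ s) 1) (≡.trans (≡.cong (m ∸_) (ℕ.+-comm (s ℕ.+ s) 1))
           (≡.sym (ℕ.∸-+-assoc m (suc s) s)))
    m∸s≡ : m ∸ s ≡ suc (m ∸ suc s)
    m∸s≡ = ℕ.+-∸-assoc 1 s<m
    term : ∀ j → j < r → N (suc s ℕ.+ j) ℕ.* N (m ∸ (suc s ℕ.+ j)) ≤ q ^ M (suc s) ℕ.* q ^ M (m ∸ suc s)
    term j j<r = ≡.subst₂ (λ x y → N (suc s ℕ.+ j) ℕ.* N x ≤ q ^ M (suc s) ℕ.* q ^ M y)
        (≡.sym m∸≡) (≡.trans (≡.cong (ℕ._+ j) (≡.sym m∸≡)) l+j≡)
        (N*N≤ (suc s) j (m ∸ (suc s ℕ.+ j) ∸ suc s))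
      where
      j<m∸s∸s : suc j ℕ.+ s ≤ m ∸ suc s
      j<m∸s∸s = ℕ.≤-trans (ℕ.+-monoˡ-≤ s j<)
        (ℕ.≤-reflexive (ℕ.m∸n+n≡m {m ∸ suc s} {s} (ℕ.<⇒≤ (ℕ.m∸n≢0⇒n<m (ℕ.>⇒≢ (ℕ.≤-<-trans z≤n j<))))))
        where
        j< : j < m ∸ suc s ∸ s
        j< = ≡.subst (j <_) r≡ j<r
      m∸≡ : m ∸ (suc s ℕ.+ j) ≡ suc s ℕ.+ (m ∸ (suc s ℕ.+ j) ∸ suc s)
      m∸≡ = ≡.sym (ℕ.m+[n∸m]≡n (≡.subst (suc s ≤_) (ℕ.∸-+-assoc m (suc s) j)
        (ℕ.m+n≤o⇒m≤o∸n (suc s) (≡.subst (_≤ m ∸ suc s) (≡.cong suc (ℕ.+-comm j s)) j<m∸s∸s))))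
      l+j≡ : m ∸ (suc s ℕ.+ j) ℕ.+ j ≡ m ∸ suc s
      l+j≡ = ≡.trans (≡.cong (ℕ._+ j) (≡.sym (ℕ.∸-+-assoc m (suc s) j)))
        (ℕ.m∸n+n≡m (ℕ.≤-trans (ℕ.n≤1+n j) (ℕ.≤-trans (ℕ.m≤m+n (suc j) s) j<m∸s∸s)))
    middle : ∑ r (λ j → N (suc s ℕ.+ j) ℕ.* N (m ∸ (suc s ℕ.+ j))) ≤ q ^ M (suc s) ℕ.* q ^ M (m ∸ s)
    middle = begin
      ∑ r (λ j → N (suc s ℕ.+ j) ℕ.* N (m ∸ (suc s ℕ.+ j)))
        ≤⟨ ∑-mono-≤ r term ⟩
      ∑ r (λ _ → q ^ M (suc s) ℕ.* q ^ M (m ∸ suc s))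
        ≡⟨ ∑-const r _ ⟩
      r ℕ.* (q ^ M (suc s) ℕ.* q ^ M (m ∸ suc s))
        ≡⟨ x∙yz≈y∙xz r (q ^ M (suc s)) _ ⟩
      q ^ M (suc s) ℕ.* (r ℕ.* q ^ M (m ∸ suc s))
        ≤⟨ ℕ.*-monoʳ-≤ (q ^ M (suc s)) (ℕ.*-monoˡ-≤ (q ^ M (m ∸ suc s))
             (ℕ.≤-trans (≡.subst (_≤ m ∸ suc s) (≡.sym r≡) (ℕ.m∸n≤m _ s)) (n≤q^n 2≤q (m ∸ suc s)))) ⟩
      q ^ M (suc s) ℕ.* (q ^ (m ∸ suc s) ℕ.* q ^ M (m ∸ suc s))
        ≡⟨ ≡.cong (q ^ M (suc s) ℕ.*_) (ℕ.^-distribˡ-+-* q (m ∸ suc s) _) ⟨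
      q ^ M (suc s) ℕ.* q ^ (m ∸ suc s ℕ.+ M (m ∸ suc s))
        ≤⟨ ℕ.*-monoʳ-≤ (q ^ M (suc s)) (ℕ.^-monoʳ-≤ q (monomials-gap 2≤k (m ∸ suc s))) ⟩
      q ^ M (suc s) ℕ.* q ^ M (suc (m ∸ suc s))
        ≡⟨ ≡.cong (λ d → q ^ M (suc s) ℕ.* q ^ M d) m∸s≡ ⟨
      q ^ M (suc s) ℕ.* q ^ M (m ∸ s) ∎
      where open Algebra.Properties.CommutativeSemigroup ℕ.*-commutativeSemigroup using (x∙yz≈y∙xz)

-- Inversion of the truncated Cauchy product

open Algebra.Properties.Semiring.Sum ℤ.+-*-semiring using (∑-distrib-+; *-distribʳ-sum)

∑ℤ-cong : ∀ n (f g : ℕ → ℤ) → (∀ i → i < n → f i ≡ g i) → ∑ℤ n f ≡ ∑ℤ n g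
∑ℤ-cong zero    f g f≡g = ≡.refl
∑ℤ-cong (suc n) f g f≡g = ≡.cong₂ _+ℤ_ (f≡g 0 (s≤s z≤n)) (∑ℤ-cong n (f ∘ suc) (g ∘ suc) λ i i<n → f≡g (suc i) (s≤s i<n))

∑ℤ-distrib-+ : ∀ n (f g : ℕ → ℤ) → ∑ℤ n (λ i → f i +ℤ g i) ≡ ∑ℤ n f +ℤ ∑ℤ n g
∑ℤ-distrib-+ n f g = ∑-distrib-+ {n} (f ∘ toℕ) (g ∘ toℕ)

∑ℤ-last : ∀ n (f : ℕ → ℤ) → ∑ℤ (suc n) f ≡ ∑ℤ n f +ℤ f n
∑ℤ-last zero    f = ℤ.+-comm (f 0) 0ℤ
∑ℤ-last (suc n) f = ≡.trans (≡.cong (f 0 +ℤ_) (∑ℤ-last n (f ∘ suc))) (≡.sym (ℤ.+-assoc (f 0) _ _))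

∑ℤ-*ʳ : ∀ n (f : ℕ → ℤ) x → ∑ℤ n (λ i → f i *ℤ x) ≡ ∑ℤ n f *ℤ x
∑ℤ-*ʳ n f x = ≡.sym (*-distribʳ-sum {n} x (f ∘ toℕ))

∑ℤ-*ˡ : ∀ n (f : ℕ → ℤ) x → ∑ℤ n (λ i → x *ℤ f i) ≡ x *ℤ ∑ℤ n f
∑ℤ-*ˡ n f x = ≡.trans (∑ℤ-cong n (λ i → x *ℤ f i) (λ i → f i *ℤ x) λ i _ → ℤ.*-comm x (f i)) (≡.trans (∑ℤ-*ʳ n f x) (ℤ.*-comm (∑ℤ n f) x))

∑ℤ-pos : ∀ n (f : ℕ → ℕ) → ∑ℤ n (λ i → + f i) ≡ + ∑ n f
∑ℤ-pos zero    f = ≡.refl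
∑ℤ-pos (suc n) f = ≡.cong (+ f 0 +ℤ_) (∑ℤ-pos n (f ∘ suc))

∑ℤ-zero : ∀ n (f : ℕ → ℤ) → (∀ i → f i ≡ 0ℤ) → ∑ℤ n f ≡ 0ℤ
∑ℤ-zero zero    f f≡0 = ≡.refl
∑ℤ-zero (suc n) f f≡0 = ≡.cong₂ _+ℤ_ (f≡0 0) (∑ℤ-zero n (f ∘ suc) (f≡0 ∘ suc))

∣∑ℤ∣≤ : ∀ n (f : ℕ → ℤ) → ∣ ∑ℤ n f ∣ ≤ ∑ n (λ i → ∣ f i ∣)
∣∑ℤ∣≤ zero    f = z≤n
∣∑ℤ∣≤ (suc n) f = ℕ.≤-trans (ℤ.∣i+j∣≤∣i∣+∣j∣ (f 0) _) (ℕ.+-monoʳ-≤ ∣ f 0 ∣ (∣∑ℤ∣≤ n (f ∘ suc)))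

∑-*ʳ : ∀ n (f : ℕ → ℕ) x → ∑ n (λ i → f i ℕ.* x) ≡ ∑ n f ℕ.* x
∑-*ʳ zero    f x = ≡.refl
∑-*ʳ (suc n) f x = ≡.trans (≡.cong (f 0 ℕ.* x ℕ.+_) (∑-*ʳ n (f ∘ suc) x)) (≡.sym (ℕ.*-distribʳ-+ x (f 0) _))

-- Both sides add up F i j over the triangle i + j ≤ t, on the left by rows i and on the right by
-- diagonals s = i + j.
∑ℤ-triangle : ∀ t (F : ℕ → ℕ → ℤ) →
  ∑ℤ (suc t) (λ i → ∑ℤ (suc (t ∸ i)) (F i)) ≡ ∑ℤ (suc t) (λ s → ∑ℤ (suc s) (λ i → F i (s ∸ i)))
∑ℤ-triangle zero    F = ≡.refl
∑ℤ-triangle (suc t) F = begin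
  ∑ℤ (suc (suc t)) (F 0) +ℤ ∑ℤ (suc t) (λ i → ∑ℤ (suc (t ∸ i)) (F (suc i)))
    ≡⟨ ≡.cong (∑ℤ (suc (suc t)) (F 0) +ℤ_) (∑ℤ-triangle t (F ∘ suc)) ⟩
  ∑ℤ (suc (suc t)) (F 0) +ℤ ∑ℤ (suc t) (λ s → ∑ℤ (suc s) (λ i → F (suc i) (s ∸ i)))
    -- An empty inner sum is put in front for s = 0, so that both outer sums have the same range.
    ≡⟨ ≡.cong (∑ℤ (suc (suc t)) (F 0) +ℤ_) (ℤ.+-identityˡ _) ⟨
  ∑ℤ (suc (suc t)) (F 0) +ℤ ∑ℤ (suc (suc t)) (λ s → ∑ℤ s (λ i → F (suc i) (s ∸ suc i)))
    ≡⟨ ∑ℤ-distrib-+ (suc (suc t)) (F 0) (λ s → ∑ℤ s (λ i → F (suc i) (s ∸ suc i))) ⟨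
  ∑ℤ (suc (suc t)) (λ s → ∑ℤ (suc s) (λ i → F i (s ∸ i))) ∎
  where open ≡.≡-Reasoning

module Inversion (N I Q B : ℕ → ℕ) (N₀≡1 : N 0 ≡ 1) (α : ℕ → ℤ) (α₀≡1 : α 0 ≡ 1ℤ)
  (α-rec : ∀ i → 0 < i → α i ≡ - ∑ℤ i (λ j → + N (i ∸ j) *ℤ α j)) where

  -- The recurrence says that the generating series of α and N are inverse to each other; this is
  -- the coefficient in degree s + 1, where N 0 = 1 isolates `α (suc s)`.
  α*N : ∀ s → ∑ℤ (suc (suc s)) (λ i → α i *ℤ + N (suc s ∸ i)) ≡ 0ℤ
  α*N s = begin
    ∑ℤ (suc (suc s)) (λ i → α i *ℤ + N (suc s ∸ i))
      ≡⟨ ∑ℤ-last (suc s) (λ i → α i *ℤ + N (suc s ∸ i)) ⟩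
    ∑ℤ (suc s) (λ i → α i *ℤ + N (suc s ∸ i)) +ℤ α (suc s) *ℤ + N (suc s ∸ suc s)
      ≡⟨ ≡.cong₂ _+ℤ_ (∑ℤ-cong (suc s) (λ i → α i *ℤ + N (suc s ∸ i)) (λ i → + N (suc s ∸ i) *ℤ α i)
             λ i _ → ℤ.*-comm (α i) (+ N (suc s ∸ i)))
           (≡.cong₂ _*ℤ_ (α-rec (suc s) (s≤s z≤n))
             (≡.cong +_ (≡.trans (≡.cong N (ℕ.n∸n≡0 s)) N₀≡1))) ⟩
    S +ℤ - S *ℤ 1ℤ  ≡⟨ ≡.cong (S +ℤ_) (ℤ.*-identityʳ (- S)) ⟩
    S +ℤ - S        ≡⟨ ℤ.+-inverseʳ S ⟩
    0ℤ              ∎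
    where
    open ≡.≡-Reasoning
    S : ℤ
    S = ∑ℤ (suc s) (λ j → + N (suc s ∸ j) *ℤ α j)

  partial : ℕ → ℕ → ℕ
  partial t m = ∑ (suc t) λ j → I (m ∸ j) ℕ.* N j

  -- Truncating at t - i for m - i makes the index set exactly the triangle i + j ≤ t. On the
  -- diagonal i + j = s the factor `I (m ∸ s)` is common, and the remaining sum vanishes by `α*N`
  -- unless s = 0.
  ∑α*partial : ∀ t m → ∑ℤ (suc t) (λ i → α i *ℤ + partial (t ∸ i) (m ∸ i)) ≡ + I m
  ∑α*partial t m = begin
    ∑ℤ (suc t) (λ i → α i *ℤ + partial (t ∸ i) (m ∸ i))
      ≡⟨ ∑ℤ-cong (suc t) (λ i → α i *ℤ + partial (t ∸ i) (m ∸ i)) (λ i → ∑ℤ (suc (t ∸ i)) (F i))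
           (λ i _ → ≡.trans (≡.cong (α i *ℤ_) (≡.sym (∑ℤ-pos (suc (t ∸ i)) (λ j → I (m ∸ i ∸ j) ℕ.* N j))))
           (≡.sym (∑ℤ-*ˡ (suc (t ∸ i)) (λ j → + (I (m ∸ i ∸ j) ℕ.* N j)) (α i)))) ⟩
    ∑ℤ (suc t) (λ i → ∑ℤ (suc (t ∸ i)) (F i))
      ≡⟨ ∑ℤ-triangle t F ⟩
    ∑ℤ (suc t) (λ s → ∑ℤ (suc s) (λ i → F i (s ∸ i)))
      ≡⟨ ∑ℤ-cong (suc t) (λ s → ∑ℤ (suc s) (λ i → F i (s ∸ i)))
             (λ s → ∑ℤ (suc s) (λ i → α i *ℤ + N (s ∸ i)) *ℤ + I (m ∸ s))
           (λ s _ → ≡.trans (∑ℤ-cong (suc s) (λ i → F i (s ∸ i)) (λ i → α i *ℤ + N (s ∸ i) *ℤ + I (m ∸ s))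
               (λ i i≤s → term s i (ℕ.≤-pred i≤s)))
           (∑ℤ-*ʳ (suc s) (λ i → α i *ℤ + N (s ∸ i)) (+ I (m ∸ s)))) ⟩
    ∑ℤ (suc t) (λ s → ∑ℤ (suc s) (λ i → α i *ℤ + N (s ∸ i)) *ℤ + I (m ∸ s))
      ≡⟨ ≡.cong₂ _+ℤ_ (≡.trans (≡.cong (_*ℤ + I m) (≡.trans (ℤ.+-identityʳ _)
             (≡.cong₂ _*ℤ_ α₀≡1 (≡.cong +_ N₀≡1)))) (ℤ.*-identityˡ (+ I m)))
           (∑ℤ-zero t (λ s → ∑ℤ (suc (suc s)) (λ i → α i *ℤ + N (suc s ∸ i)) *ℤ + I (m ∸ suc s))
             λ s → ≡.cong (_*ℤ + I (m ∸ suc s)) (α*N s)) ⟩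
    + I m +ℤ 0ℤ
      ≡⟨ ℤ.+-identityʳ (+ I m) ⟩
    + I m ∎
    where
    open ≡.≡-Reasoning
    F : ℕ → ℕ → ℤ
    F i j = α i *ℤ + (I (m ∸ i ∸ j) ℕ.* N j)
    term : ∀ s i → i ≤ s → F i (s ∸ i) ≡ α i *ℤ + N (s ∸ i) *ℤ + I (m ∸ s)
    term s i i≤s = begin
      α i *ℤ + (I (m ∸ i ∸ (s ∸ i)) ℕ.* N (s ∸ i))
        ≡⟨ ≡.cong (λ n → α i *ℤ + (I n ℕ.* N (s ∸ i)))
             (≡.trans (ℕ.∸-+-assoc m i (s ∸ i)) (≡.cong (m ∸_) (ℕ.m+[n∸m]≡n i≤s))) ⟩
      α i *ℤ + (I (m ∸ s) ℕ.* N (s ∸ i))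
        ≡⟨ ≡.cong (α i *ℤ_) (≡.trans (≡.cong +_ (ℕ.*-comm (I (m ∸ s)) _)) (ℤ.pos-* (N (s ∸ i)) _)) ⟩
      α i *ℤ (+ N (s ∸ i) *ℤ + I (m ∸ s))
        ≡⟨ ℤ.*-assoc (α i) _ _ ⟨
      α i *ℤ + N (s ∸ i) *ℤ + I (m ∸ s) ∎

  -- Each `N (m ∸ i)` is a `partial` sum plus an error. The former combine to I m, so only the
  -- weighted errors remain; they share the factor `Q (m ∸ suc t)` because (m - i) - (t - i + 1) = m
  -- - t - 1 for every i.
  invert : ∀ t m →
    (∀ i → i ≤ t → partial (t ∸ i) (m ∸ i) ≤ N (m ∸ i)) →
    (∀ i → i ≤ t → N (m ∸ i) ≤ partial (t ∸ i) (m ∸ i) ℕ.+ B (t ∸ i) ℕ.* Q (m ∸ suc t)) →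
    ∣ + I m - ∑ℤ (suc t) (λ i → α i *ℤ + N (m ∸ i)) ∣ ≤
      ∑ (suc t) (λ i → ∣ α i ∣ ℕ.* B (t ∸ i)) ℕ.* Q (m ∸ suc t)
  invert t m lower upper = begin
    ∣ + I m - ∑ℤ (suc t) (λ i → α i *ℤ + N (m ∸ i)) ∣
      ≡⟨ ≡.cong (λ x → ∣ + I m - x ∣) split ⟩
    ∣ + I m - (+ I m +ℤ E) ∣
      ≡⟨ ≡.cong ∣_∣ (cancel (+ I m) E) ⟩
    ∣ - E ∣
      ≡⟨ ℤ.∣-i∣≡∣i∣ E ⟩
    ∣ E ∣
      ≤⟨ ∣∑ℤ∣≤ (suc t) (λ i → α i *ℤ + err i) ⟩
    ∑ (suc t) (λ i → ∣ α i *ℤ + err i ∣)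
      ≤⟨ ∑-mono-≤ (suc t) (λ i i≤t → ℕ.≤-trans (ℕ.≤-reflexive (ℤ.abs-* (α i) (+ err i)))
           (ℕ.≤-trans (ℕ.*-monoʳ-≤ ∣ α i ∣ (ℕ.m≤n+o⇒m∸n≤o (N (m ∸ i)) (partial (t ∸ i) (m ∸ i)) (upper i (ℕ.≤-pred i≤t))))
             (ℕ.≤-reflexive (≡.sym (ℕ.*-assoc ∣ α i ∣ (B (t ∸ i)) _))))) ⟩
    ∑ (suc t) (λ i → ∣ α i ∣ ℕ.* B (t ∸ i) ℕ.* Q (m ∸ suc t))
      ≡⟨ ∑-*ʳ (suc t) (λ i → ∣ α i ∣ ℕ.* B (t ∸ i)) _ ⟩
    ∑ (suc t) (λ i → ∣ α i ∣ ℕ.* B (t ∸ i)) ℕ.* Q (m ∸ suc t) ∎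
    where
    open ℕ.≤-Reasoning
    err : ℕ → ℕ
    err i = N (m ∸ i) ∸ partial (t ∸ i) (m ∸ i)
    E : ℤ
    E = ∑ℤ (suc t) (λ i → α i *ℤ + err i)
    split : ∑ℤ (suc t) (λ i → α i *ℤ + N (m ∸ i)) ≡ + I m +ℤ E
    split = ≡.trans (∑ℤ-cong (suc t) (λ i → α i *ℤ + N (m ∸ i))
          (λ i → α i *ℤ + partial (t ∸ i) (m ∸ i) +ℤ α i *ℤ + err i) λ i i≤t → ≡.trans
        (≡.cong (λ n → α i *ℤ + n) (≡.sym (ℕ.m+[n∸m]≡n (lower i (ℕ.≤-pred i≤t)))))
        (ℤ.*-distribˡ-+ (α i) (+ partial (t ∸ i) (m ∸ i)) (+ err i)))
      (≡.trans (∑ℤ-distrib-+ (suc t) (λ i → α i *ℤ + partial (t ∸ i) (m ∸ i)) (λ i → α i *ℤ + err i))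
        (≡.cong (_+ℤ E) (∑α*partial t m)))
    cancel : ∀ x y → x - (x +ℤ y) ≡ - y
    cancel x y = ≡.trans (≡.cong (x +ℤ_) (ℤ.neg-distrib-+ x y))
      (≡.trans (≡.sym (ℤ.+-assoc x (- x) (- y)))
        (≡.trans (≡.cong (_+ℤ - y) (ℤ.+-inverseʳ x)) (ℤ.+-identityˡ (- y))))

primePower⇒2≤ : ∀ {q} → IsPrimePower q → 2 ≤ q
primePower⇒2≤ (p , suc r , p-prime , _ , ≡.refl) = ℕ.≤-trans (ℕ.nonTrivial⇒n>1 p)
  (ℕ.≤-trans (ℕ.≤-reflexive (≡.sym (ℕ.*-identityʳ p))) (ℕ.*-monoʳ-≤ p (ℕ.m^n>0 p r)))
  where
  instance
    nonTrivial : ℕ.NonTrivial p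
    nonTrivial = prime⇒nonTrivial p-prime
    nonZero : NonZero p
    nonZero = prime⇒nonZero p-prime

open import Data.Nat.Base using (_+_; _*_)

theorem2p2 : ∀ {c ℓ} (q : ℕ) → IsPrimePower q → (F : FiniteField c ℓ q) →
    (k t : ℕ) → 2 ≤ k →
    (N I : ℕ → ℕ) →
    (∀ m → NormalizedOfDegree F k m HasCardinality N m) →
    (∀ m → IrreducibleOfDegree F k m HasCardinality I m) →
    (α : ℕ → ℤ) → α 0 ≡ 1ℤ →
    (∀ i → 0 < i → α i ≡ - ∑ℤ i (λ j → + N (i ∸ j) *ℤ α j)) →
    ∃₂ λ (B m₀ : ℕ) → ∀ m → m₀ ≤ m →
    ∣ + I m - ∑ℤ (suc t) (λ i → α i *ℤ + N (m ∸ i)) ∣ ≤ B * q ^ ((m ∸ suc t + k) C k)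
theorem2p2 q primePower F k t 2≤k N I cardN cardI α α₀≡1 α-rec =
  -- The additional t in the threshold ensures that m - i reaches `threshold (t ∸ i)` for every i ≤
  -- t.
  ∑ (suc t) (λ i → ∣ α i ∣ * B (t ∸ i)) , threshold t + t , λ m m₀≤m →
    invert t m (λ i i≤t → ∑I*N≤N {t ∸ i} (ℕ.<-≤-trans (t+t<threshold (t ∸ i)) (large i i≤t m₀≤m)))
               (λ i i≤t → upper m i i≤t (large i i≤t m₀≤m))
  where
  open IteratedPolynomials F using (ring-isGCDDomain)
  open TotalDegree F k using (A)
  open NormalizedPolynomials F k

  B Q threshold : ℕ → ℕ
  -- The constant of `balanced-≤` for s = i + 1.
  B i         = q ^ monomials k (suc i) + q ^ monomials k (suc (suc i))
  Q d         = q ^ monomials k d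
  -- This is 2s + i with s = i + 1, the size from which `N≤∑I*N+` applies with i in place of t.
  threshold i = suc i + suc i + i

  open Counting A (ring-isGCDDomain k) degreeFunction N I
    (λ m → normalized-enumeration (cardN m)) (λ m → irreducible-enumeration (cardI m))
  open Bounds q k (primePower⇒2≤ primePower) 2≤k N (λ d → normalized-≤ (cardN d))
  open Inversion N I Q B (normalized-0 (cardN 0)) α α₀≡1 α-rec

  t+t<threshold : ∀ t → t + t < threshold t
  t+t<threshold t = ℕ.≤-trans (s≤s (ℕ.+-monoʳ-≤ t (ℕ.n≤1+n t))) (ℕ.m≤m+n _ t)

  large : ∀ {m} i → i ≤ t → threshold t + t ≤ m → threshold (t ∸ i) ≤ m ∸ i
  large i i≤t m₀≤m = ℕ.m+n≤o⇒m≤o∸n _ (ℕ.≤-trans (ℕ.+-mono-≤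
    (ℕ.+-mono-≤ (ℕ.+-mono-≤ (s≤s (ℕ.m∸n≤m t i)) (s≤s (ℕ.m∸n≤m t i))) (ℕ.m∸n≤m t i)) i≤t) m₀≤m)

  upper : ∀ m i → i ≤ t → threshold (t ∸ i) ≤ m ∸ i →
          N (m ∸ i) ≤ partial (t ∸ i) (m ∸ i) + B (t ∸ i) * Q (m ∸ suc t)
  upper m i i≤t large = ≡.subst (λ d → N (m ∸ i) ≤ partial (t ∸ i) (m ∸ i) + B (t ∸ i) * Q d)
    (≡.trans (ℕ.∸-+-assoc m i (suc (t ∸ i)))
      (≡.cong (m ∸_) (≡.trans (ℕ.+-suc i (t ∸ i)) (≡.cong suc (ℕ.m+[n∸m]≡n i≤t)))))
    (ℕ.≤-trans (N≤∑I*N+ large) (ℕ.+-monoʳ-≤ (partial (t ∸ i) (m ∸ i))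
      (balanced-≤ (suc (t ∸ i)) (m ∸ i) (ℕ.≤-trans (s≤s (ℕ.m≤n+m (suc (t ∸ i)) (t ∸ i)))
        (ℕ.≤-trans (ℕ.m≤m+n _ (t ∸ i)) large)))))
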